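{- Let $Alg$ be a Strassen-like matrix multiplication algorithm with base case $n_0\times n_0$ using $m$ multiplications, where $\omega_0=\log_{n_0} m$ satisfies $2<\omega_0<3$, and whose base decoding graph $Dec_1C$ is connected. Then there exist constants $c>0$ and $c_0\ge1$, depending only on the base case, with the following property. For every $M\ge1$ and every power $n$ of $n_0$ with $n\ge c_0\sqrt M$, every implementation of $Alg$ on $n\times n$ matrices in the sequential two-level memory model with fast memory of size $M$, without recomputation, moves at least $$c\left(\frac{n}{\sqrt M}\right)^{\omega_0} M$$ words. That is, $IO(n)=\Omega\big((n/\sqrt M)^{\omega_0}M\big)$.
   Context: Strassen-like algorithm: fix a bilinear algorithm multiplying two $n_0\times n_0$ matrices with $m$ multiplications. It forms $m$ linear combinations $L_r(A)$ of entries of $A$ and $m$ linear combinations $L'_r(B)$ of entries of $B$, computes $P_r=L_r(A)L'_r(B)$ for $r=1,\dots,m$, and outputs each $C_{ij}$ as a linear combination of the $P_r$. For $n$ a power of $n_0$, the algorithm on $n\times n$ matrices proceeds as follows: - Split $A,B$ into $n_0^2$ blocks of size $\frac{n}{n_0}\times\frac{n}{n_0}$. - Form the same linear combinations of blocks, computed entrywise by binary scalar additions, subtractions and scalar multiplications. - Multiply the $m$ block pairs by recursive calls; for $n=1$ use a scalar multiplication. - Combine the block products into the blocks of $C$ via the same linear combinations, again entrywise. The base decoding graph $Dec_1C$ is the bipartite graph on the $m$ product vertices $P_1,\dots,P_m$ and the $n_0^2$ output vertices $C_{ij}$. It has an edge $C_{ij}P_r$ iff $P_r$ has a nonzero coefficient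 in the expression of $C_{ij}$. Strassen's algorithm ($n_0=2$, $m=7$) and Winograd's variant satisfy the connectivity hypothesis; the classical algorithm does not. Computation graph (CDAG): a directed acyclic graph with one vertex per input entry and one vertex per scalar arithmetic operation. There is an edge $(u,v)$ whenever the value of $u$ is an operand of the operation $v$. Sequential two-level memory model: - There is a fast memory holding at most $M$ words and an unbounded slow memory. - Inputs start in slow memory, and outputs must end in slow memory. - Arithmetic operations require their operands to be in fast memory and place their results there. - Each word read from slow to fast memory, or written from fast to slow memory, costs one unit. An implementation computes every CDAG vertex exactly once (no recomputation), in an order consistent with the edges. $IO(n)$ is the minimum number of words moved over all implementations. -}

module Defs where

open import Algebra.Bundles using (CommutativeRing)
import Algebra.Properties.CommutativeMonoid.Sum as MonoidSum
open import Data.Fin.Base using (Fin; zero; suc; combine; remQuot)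
open import Data.List.Base using (List; []; _∷_; map; length; _++_; allFin; cartesianProduct)
open import Data.List.Membership.Propositional using (_∈_; _∉_)
open import Data.List.Relation.Binary.Subset.Propositional using (_⊆_)
open import Data.List.Relation.Unary.All using (All)
open import Data.Nat.Base using (ℕ; zero; suc; _+_; _*_; _^_; _≤_; _<_; NonZero)
open import Data.Product.Base using (_×_; _,_)
open import Data.Sum.Base as Sum using (_⊎_; inj₁; inj₂; [_,_]′)
open import Function.Base using (_∘_)
open import Level using (Level; _⊔_)
open import Relation.Binary.Construct.Closure.Equivalence using (EqClosure)
open import Relation.Nullary.Negation using (¬_)

------------------------------------------------------------------------
-- Bilinear algorithms and their base decoding graph

module Bilinear {c ℓ : Level} (R : CommutativeRing c ℓ) where

  private
    module R = CommutativeRing R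
    open MonoidSum R.+-commutativeMonoid using (sum)

  Matrix : ℕ → Set c
  Matrix n = Fin n × Fin n → R.Carrier

  linComb : ∀ {m} → (Fin m → R.Carrier) → (Fin m → R.Carrier) → R.Carrier
  linComb u x = sum λ r → u r R.* x r

  linCombEntries : ∀ {n} → Matrix n → Matrix n → R.Carrier
  linCombEntries u x = sum λ i → sum λ j → u (i , j) R.* x (i , j)

  matMul : ∀ {n} → Matrix n → Matrix n → Matrix n
  matMul A B (i , j) = sum λ l → A (i , l) R.* B (l , j)

  record BilinearAlgorithm (n₀ m : ℕ) : Set (c ⊔ ℓ) where
    field
      coeffA : Fin m → Matrix n₀
      coeffB : Fin m → Matrix n₀
      coeffC : Fin n₀ × Fin n₀ → Fin m → R.Carrier

    L : Fin m → Matrix n₀ → R.Carrier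
    L r A = linCombEntries (coeffA r) A

    L′ : Fin m → Matrix n₀ → R.Carrier
    L′ r B = linCombEntries (coeffB r) B

    field
      correct : ∀ A B ij →
        linComb (coeffC ij) (λ r → L r A R.* L′ r B) R.≈ matMul A B ij

  data Dec₁Vertex (n₀ m : ℕ) : Set where
    product : Fin m → Dec₁Vertex n₀ m
    output  : Fin n₀ × Fin n₀ → Dec₁Vertex n₀ m

  data Dec₁Edge {n₀ m} (alg : BilinearAlgorithm n₀ m) :
                Dec₁Vertex n₀ m → Dec₁Vertex n₀ m → Set ℓ where
    edge : ∀ {ij r} → ¬ (BilinearAlgorithm.coeffC alg ij r R.≈ R.0#) →
           Dec₁Edge alg (output ij) (product r)

  Dec₁Connected : ∀ {n₀ m} → BilinearAlgorithm n₀ m → Set ℓ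
  Dec₁Connected alg = ∀ u v → EqClosure (Dec₁Edge alg) u v

  ----------------------------------------------------------------------
  -- Evaluating linear combinations by binary scalar operations
  --
  -- The coefficients alone do not say by which additions, subtractions
  -- and scalar multiplications the linear combinations are evaluated.
  -- A straight-line program fixes this, and may share intermediate
  -- results (as Winograd's variant does).

  -- A wire is an input or the result of a gate.  Gates are numbered
  -- from the most recent one (zero) backwards.
  Wire : Set → ℕ → Set
  Wire X s = X ⊎ Fin s

  data Gate (W : Set) : Set c where
    add sub : W → W → Gate W
    scale   : R.Carrier → W → Gate W

  gateOperands : ∀ {W} → Gate W → List W
  gateOperands (add v w)   = v ∷ w ∷ []
  gateOperands (sub v w)   = v ∷ w ∷ []
  gateOperands (scale _ w) = w ∷ []

  gateValue : ∀ {W} → (W → R.Carrier) → Gate W → R.Carrier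
  gateValue x (add v w)   = x v R.+ x w
  gateValue x (sub v w)   = x v R.- x w
  gateValue x (scale a w) = a R.* x w

  infixl 5 _▸_
  data Program (X : Set) : ℕ → Set c where
    []  : Program X 0
    _▸_ : ∀ {s} → Program X s → Gate (Wire X s) → Program X (suc s)

  operandsOf : ∀ {X s} → Program X s → Fin s → List (Wire X s)
  operandsOf (p ▸ g) zero    = map (Sum.map₂ suc) (gateOperands g)
  operandsOf (p ▸ g) (suc j) = map (Sum.map₂ suc) (operandsOf p j)

  wireValue : ∀ {X s} → Program X s → (X → R.Carrier) → Wire X s → R.Carrier
  wireValue p       x (inj₁ i)       = x i
  wireValue (p ▸ g) x (inj₂ zero)    = gateValue (wireValue p x) g
  wireValue (p ▸ g) x (inj₂ (suc j)) = wireValue p x (inj₂ j)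

  record LinearCircuit (X Y : Set) : Set c where
    field
      gates   : ℕ
      program : Program X gates
      out     : Y → Wire X gates

    value : (X → R.Carrier) → Y → R.Carrier
    value x y = wireValue program x (out y)

  record Evaluation {n₀ m} (alg : BilinearAlgorithm n₀ m) : Set (c ⊔ ℓ) where
    open BilinearAlgorithm alg
    field
      encA : LinearCircuit (Fin n₀ × Fin n₀) (Fin m)
      encB : LinearCircuit (Fin n₀ × Fin n₀) (Fin m)
      decC : LinearCircuit (Fin m) (Fin n₀ × Fin n₀)
      encA-computes : ∀ A r → LinearCircuit.value encA A r R.≈ L r A
      encB-computes : ∀ B r → LinearCircuit.value encB B r R.≈ L′ r B
      decC-computes : ∀ P ij → LinearCircuit.value decC P ij R.≈ linComb (coeffC ij) P

------------------------------------------------------------------------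
-- Computation graphs

record ComputationGraph : Set₁ where
  field
    Input     : Set
    Operation : Set
    Output    : Set

  Vertex : Set
  Vertex = Input ⊎ Operation

  -- There is an edge (u , inj₂ o) exactly when u ∈ operands o.
  field
    operands : Operation → List Vertex
    inputs   : List Input
    outputVertex : Output → Vertex

Entry : ℕ → Set
Entry n = Fin n × Fin n

-- Entry e of block IJ, as an entry of the whole matrix.
inBlock : ∀ {n₀ n} → Entry n₀ → Entry n → Entry (n₀ * n)
inBlock (I , J) (i , j) = combine I i , combine J j

splitEntry : ∀ n₀ n → Entry (n₀ * n) → Entry n₀ × Entry n
splitEntry n₀ n (i , j) =
  let (I , i′) = remQuot {n₀} n i
      (J , j′) = remQuot {n₀} n j
  in (I , J) , (i′ , j′)

module Recursion {c ℓ : Level} {R : CommutativeRing c ℓ} {n₀ m : ℕ}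
                 {alg : Bilinear.BilinearAlgorithm R n₀ m}
                 (ev : Bilinear.Evaluation R alg) where

  open Bilinear R
  open Evaluation ev
  private
    module EncA = LinearCircuit encA
    module EncB = LinearCircuit encB
    module DecC = LinearCircuit decC

  -- The scalar operations of the algorithm on n₀ ^ k × n₀ ^ k matrices.
  -- Every gate of a base circuit is executed once for each entry of a block.
  data Op : ℕ → Set where
    mult  : Op zero
    gateA : ∀ {k} → Fin EncA.gates → Entry (n₀ ^ k) → Op (suc k)
    gateB : ∀ {k} → Fin EncB.gates → Entry (n₀ ^ k) → Op (suc k)
    call  : ∀ {k} → Fin m → Op k → Op (suc k)
    gateC : ∀ {k} → Fin DecC.gates → Entry (n₀ ^ k) → Op (suc k)

  -- One call of the algorithm inside a graph with vertices V: a and b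
  -- give the vertices holding its arguments and emb places its operations.
  module _ {V : Set} where

    argA : ∀ {k} (a : Entry (n₀ ^ suc k) → V) (emb : Op (suc k) → V) →
           Entry (n₀ ^ k) → Wire (Entry n₀) EncA.gates → V
    argA a emb e = [ (λ IJ → a (inBlock IJ e)) , (λ g → emb (gateA g e)) ]′

    argB : ∀ {k} (b : Entry (n₀ ^ suc k) → V) (emb : Op (suc k) → V) →
           Entry (n₀ ^ k) → Wire (Entry n₀) EncB.gates → V
    argB b emb e = [ (λ IJ → b (inBlock IJ e)) , (λ g → emb (gateB g e)) ]′

    subA : ∀ {k} → (Entry (n₀ ^ suc k) → V) → (Op (suc k) → V) →
           Fin m → Entry (n₀ ^ k) → V
    subA a emb r e = argA a emb e (EncA.out r)

    subB : ∀ {k} → (Entry (n₀ ^ suc k) → V) → (Op (suc k) → V) →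
           Fin m → Entry (n₀ ^ k) → V
    subB b emb r e = argB b emb e (EncB.out r)

    mutual
      argC : ∀ k (a b : Entry (n₀ ^ suc k) → V) (emb : Op (suc k) → V) →
             Entry (n₀ ^ k) → Wire (Fin m) DecC.gates → V
      argC k a b emb e (inj₁ r) =
        result k (subA a emb r) (subB b emb r) (emb ∘ call r) e
      argC k a b emb e (inj₂ g) = emb (gateC g e)

      result : ∀ k (a b : Entry (n₀ ^ k) → V) (emb : Op k → V) →
               Entry (n₀ ^ k) → V
      result zero    a b emb _  = emb mult
      result (suc k) a b emb ij =
        let (IJ , e) = splitEntry n₀ (n₀ ^ k) ij in argC k a b emb e (DecC.out IJ)

    opOperands : ∀ k (a b : Entry (n₀ ^ k) → V) (emb : Op k → V) → Op k → List V
    opOperands zero    a b emb mult        = a (zero , zero) ∷ b (zero , zero) ∷ []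
    opOperands (suc k) a b emb (gateA g e) = map (argA a emb e) (operandsOf EncA.program g)
    opOperands (suc k) a b emb (gateB g e) = map (argB b emb e) (operandsOf EncB.program g)
    opOperands (suc k) a b emb (call r o)  =
      opOperands k (subA a emb r) (subB b emb r) (emb ∘ call r) o
    opOperands (suc k) a b emb (gateC g e) = map (argC k a b emb e) (operandsOf DecC.program g)

  -- The left and right summands of Input are the entries of A and of B.
  graph : ℕ → ComputationGraph
  graph k = record
    { Input     = Entry (n₀ ^ k) ⊎ Entry (n₀ ^ k)
    ; Operation = Op k
    ; Output    = Entry (n₀ ^ k)
    ; operands  = opOperands k (inj₁ ∘ inj₁) (inj₁ ∘ inj₂) inj₂
    ; inputs    = map inj₁ entries ++ map inj₂ entries
    ; outputVertex = result k (inj₁ ∘ inj₁) (inj₁ ∘ inj₂) inj₂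
    }
    where
    entries : List (Entry (n₀ ^ k))
    entries = cartesianProduct (allFin (n₀ ^ k)) (allFin (n₀ ^ k))

------------------------------------------------------------------------
-- The sequential two-level memory model

module TwoLevelMemory (G : ComputationGraph) (M : ℕ) where

  open ComputationGraph G

  record State : Set where
    constructor ⟨_,_,_⟩
    field
      fast     : List Vertex
      slow     : List Vertex
      computed : List Operation

  -- s ⟶[ w ] s′: one step moving w words.  Bringing a word into fast
  -- memory may discard others free of charge; kept are those that remain,
  -- so the result of an operation may overwrite one of its operands.
  data _⟶[_]_ : State → ℕ → State → Set where
    read : ∀ {fast slow computed kept v} →
      v ∈ slow → kept ⊆ fast → length (v ∷ kept) ≤ M →
      ⟨ fast , slow , computed ⟩ ⟶[ 1 ] ⟨ v ∷ kept , slow , computed ⟩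
    write : ∀ {fast slow computed v} →
      v ∈ fast →
      ⟨ fast , slow , computed ⟩ ⟶[ 1 ] ⟨ fast , v ∷ slow , computed ⟩
    compute : ∀ {fast slow computed kept o} →
      All (_∈ fast) (operands o) → o ∉ computed →
      kept ⊆ fast → length (inj₂ o ∷ kept) ≤ M →
      ⟨ fast , slow , computed ⟩ ⟶[ 0 ] ⟨ inj₂ o ∷ kept , slow , o ∷ computed ⟩

  infixr 5 _◅_
  data _⟶*[_]_ : State → ℕ → State → Set where
    ε   : ∀ {s} → s ⟶*[ 0 ] s
    _◅_ : ∀ {s s′ s″ w w′} → s ⟶[ w ] s′ → s′ ⟶*[ w′ ] s″ → s ⟶*[ w + w′ ] s″

  initial : State
  initial = ⟨ [] , map inj₁ inputs , [] ⟩

  record Implementation : Set where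
    field
      words         : ℕ
      final         : State
      run           : initial ⟶*[ words ] final
      computes-all  : ∀ o → o ∈ State.computed final
      stores-output : ∀ y → outputVertex y ∈ State.slow final

------------------------------------------------------------------------
-- Comparisons with real numbers
--
-- For b ≥ 2 and a ≥ 1 the real number log_b a is given by its Dedekind cut:
-- for q > 0, p / q < log_b a iff b ^ p < a ^ q, and log_b a < p / q iff
-- a ^ q < b ^ p.

_/_<log[_]_ : (p q : ℕ) .{{_ : NonZero q}} (b a : ℕ) → Set
p / q <log[ b ] a = b ^ p < a ^ q

log[_]_<_/_ : (b a p q : ℕ) .{{_ : NonZero q}} → Set
log[ b ] a < p / q = a ^ q < b ^ p

-- n ≥ c₀ √M, squared.
_≥_√_ : ℕ → ℕ → ℕ → Set
n ≥ c₀ √ M = c₀ ^ 2 * M ≤ n ^ 2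

-- words ≥ (c₁ / c₂) (n / √M) ^ ω M, where ω = log_b a, c₂ > 0, M > 0 and
-- n ≥ √M.  Since n / √M ≥ 1 and ω > 0, (n / √M) ^ ω is the supremum of
-- (n / √M) ^ (p / q) over the rationals 0 ≤ p / q < ω.  The inequality
-- for p / q is raised to the power 2 q and cleared of denominators.
WordsAtLeast : (words c₁ c₂ b a n M : ℕ) → Set
WordsAtLeast words c₁ c₂ b a n M =
  ∀ p q .{{_ : NonZero q}} → p / q <log[ b ] a →
  (c₁ * M) ^ (2 * q) * n ^ (2 * p) ≤ (c₂ * words) ^ (2 * q) * M ^ p

{-# OPTIONS --safe #-}
module Submission where

-- Cut the recursion at subproblems of size n₀ ^ j with (n₀ ^ j)² of order M.  Consider
-- one of them when 4 n₀² M of its outputs have been computed, at most half of them.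
-- By the connectivity of Dec₁ every copy of Dec₁ in its decoding graph either is wholly
-- computed, or wholly uncomputed, or has a computed wire feeding an uncomputed gate.
-- Without recomputation the value on such a wire must then be in fast or slow memory.
-- If few copies at the top level are of the last kind, then each of the m ≥ n₀² subcalls
-- sees nearly the same fractions of computed and of uncomputed outputs.  By induction on j
-- the memories thus hold at least 1 / n₀² times the smaller number of outputs, that is 4 M
-- wires.  A vertex is a wire of at most two copies, so at most 2 M of these wires are in
-- fast memory, and the values of the others were written to slow memory.  The m ^ (k - j)
-- subproblems have disjoint decoding graphs, which gives m ^ (k - j) M words in total.

open import Algebra.Bundles using (CommutativeRing)
import Algebra.Properties.CommutativeMonoid.Sum as MonoidSum
import Algebra.Properties.CommutativeSemigroup as CommutativeSemigroup
open import Data.Bool.Base using (Bool; true; false; not; _∨_; if_then_else_)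
import Data.Bool.Properties as Bool
open import Data.Fin.Base using (Fin; zero; suc)
import Data.Fin.Properties as Fin
open import Data.List.Base
  using (List; []; _∷_; map; length; _++_; allFin; cartesianProduct; cartesianProductWith)
import Data.List.Membership.DecPropositional as DecMembership
open import Data.List.Membership.Propositional using (_∈_; _∉_)
open import Data.List.Membership.Propositional.Properties
  using (∈-map⁺; ∈-map⁻; ∈-allFin; ∈-cartesianProductWith⁻)
open import Data.List.Properties using (map-∘; map-++; map-cong; length-map; length-tabulate)
open import Data.List.Relation.Unary.All as All using (All; []; _∷_)
open import Data.List.Relation.Unary.AllPairs using ([]; _∷_)
open import Data.List.Relation.Unary.Any using (here; there)
open import Data.List.Relation.Unary.Unique.Propositional using (Unique)
import Data.List.Relation.Unary.Unique.Propositional.Properties as Unique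
open import Data.Nat.Base using (ℕ; zero; suc; NonZero; _^_; _≤_; _<_)
open import Data.Nat.ListAction using (sum)
open import Data.Nat.ListAction.Properties using (sum-++)
import Data.Nat.Properties as ℕ
open import Data.Nat.Solver using (module +-*-Solver)
open import Data.Product.Base using (_×_; _,_; proj₁; proj₂; ∃-syntax)
open import Data.Product.Properties using (≡-dec; ,-injective)
open import Data.Sum.Base as Sum using (_⊎_; inj₁; inj₂)
open import Data.Vec.Base using (Vec; []; _∷_)
open import Function.Base using (_∘_; id)
open import Level using (Level)
open import Relation.Binary.Construct.Closure.Equivalence using (gfold)
open import Relation.Binary.Definitions using (DecidableEquality)
open import Relation.Binary.PropositionalEquality
  using (_≡_; _≢_; refl; sym; trans; cong; cong₂; subst; isEquivalence; module ≡-Reasoning)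
open import Relation.Nullary using (¬_; Dec; yes; no; does; contradiction)
open import Relation.Nullary.Decidable using (dec-true; map′; _×-dec_)
open import Defs

-- Linear circuits and the base decoding graph over the ring

module RingFacts {c ℓ : Level} (R : CommutativeRing c ℓ) where

  open CommutativeRing R hiding (isEquivalence; zero)
    renaming (refl to ≈-refl; sym to ≈-sym; trans to ≈-trans; reflexive to ≈-reflexive)
  open Bilinear R
  module Sums = MonoidSum +-commutativeMonoid
  open Sums using () renaming (sum to sumᴿ)
  open import Algebra.Properties.Ring ring using (-0#≈0#)
  open import Relation.Binary.Reasoning.Setoid setoid

  sum-zero : ∀ {n} (f : Fin n → Carrier) → (∀ i → f i ≈ 0#) → sumᴿ f ≈ 0#
  sum-zero {n} f f≈0 = ≈-trans (Sums.sum-cong-≋ f≈0) (Sums.sum-replicate-zero n)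

  sum-single : ∀ {n} (f : Fin n → Carrier) i → (∀ j → j ≢ i → f j ≈ 0#) → sumᴿ f ≈ f i
  sum-single f zero    f≈0 = ≈-trans (+-congˡ (sum-zero (f ∘ suc) (λ j → f≈0 (suc j) λ ()))) (+-identityʳ _)
  sum-single f (suc i) f≈0 = ≈-trans (+-cong (f≈0 zero λ ()) (sum-single (f ∘ suc) i
    (λ j j≢i → f≈0 (suc j) (j≢i ∘ Fin.suc-injective)))) (+-identityˡ _)

  δ : ∀ {n} → Fin n → Fin n → Carrier
  δ i j = if does (i Fin.≟ j) then 1# else 0#

  δ-diag : ∀ {n} (i : Fin n) → δ i i ≡ 1#
  δ-diag i with i Fin.≟ i
  ... | yes _  = refl
  ... | no i≢i = contradiction refl i≢i

  δ-off : ∀ {n} {i j : Fin n} → i ≢ j → δ i j ≡ 0#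
  δ-off {i = i} {j} i≢j with i Fin.≟ j
  ... | yes i≡j = contradiction i≡j i≢j
  ... | no _    = refl

  linComb-δ : ∀ {n} (u : Fin n → Carrier) r → linComb u (δ r) ≈ u r
  linComb-δ u r = begin
    linComb u (δ r) ≈⟨ sum-single (λ i → u i * δ r i) r
                         (λ j j≢r → ≈-trans (*-congˡ (≈-reflexive (δ-off (j≢r ∘ sym)))) (zeroʳ _)) ⟩
    u r * δ r r     ≈⟨ *-congˡ (≈-reflexive (δ-diag r)) ⟩
    u r * 1#        ≈⟨ *-identityʳ _ ⟩
    u r             ∎

  -- The matrix unit E_ij; products of matrix units serve as test inputs for the decoding circuit.
  unit : ∀ {n} → Fin n → Fin n → Matrix n
  unit i j (i′ , j′) = δ i i′ * δ j j′

  matMul-unit : ∀ {n} (i l l′ j i′ j′ : Fin n) →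
    matMul (unit i l) (unit l′ j) (i′ , j′) ≈ δ i i′ * (δ l′ l * δ j j′)
  matMul-unit i l l′ j i′ j′ = begin
    matMul (unit i l) (unit l′ j) (i′ , j′)
      ≈⟨ sum-single (λ y → δ i i′ * δ l y * (δ l′ y * δ j j′)) l
           (λ y y≢l → ≈-trans (*-congʳ (≈-trans (*-congˡ (≈-reflexive (δ-off (y≢l ∘ sym)))) (zeroʳ _))) (zeroˡ _)) ⟩
    δ i i′ * δ l l * (δ l′ l * δ j j′)
      ≈⟨ *-congʳ (≈-trans (*-congˡ (≈-reflexive (δ-diag l))) (*-identityʳ _)) ⟩
    δ i i′ * (δ l′ l * δ j j′) ∎

  matMul-unit-diag : ∀ {n} (i l j : Fin n) → matMul (unit i l) (unit l j) (i , j) ≈ 1#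
  matMul-unit-diag i l j = begin
    matMul (unit i l) (unit l j) (i , j) ≈⟨ matMul-unit i l l j i j ⟩
    δ i i * (δ l l * δ j j) ≈⟨ *-cong (≈-reflexive (δ-diag i))
                                 (*-cong (≈-reflexive (δ-diag l)) (≈-reflexive (δ-diag j))) ⟩
    1# * (1# * 1#) ≈⟨ *-identityˡ _ ⟩
    1# * 1# ≈⟨ *-identityˡ _ ⟩
    1# ∎

  matMul-unit-inner : ∀ {n} {l l′ : Fin n} (i j : Fin n) → l ≢ l′ →
    matMul (unit i l) (unit l′ j) (i , j) ≈ 0#
  matMul-unit-inner {l = l} {l′} i j l≢l′ = begin
    matMul (unit i l) (unit l′ j) (i , j) ≈⟨ matMul-unit i l l′ j i j ⟩
    δ i i * (δ l′ l * δ j j) ≈⟨ *-congˡ (*-congʳ (≈-reflexive (δ-off (l≢l′ ∘ sym)))) ⟩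
    δ i i * (0# * δ j j) ≈⟨ *-congˡ (zeroˡ _) ⟩
    δ i i * 0# ≈⟨ zeroʳ _ ⟩
    0# ∎

  matMul-unit-outer : ∀ {n} {i j i′ j′ : Fin n} (l : Fin n) → (i , j) ≢ (i′ , j′) →
    matMul (unit i l) (unit l j) (i′ , j′) ≈ 0#
  matMul-unit-outer {i = i} {j} {i′} {j′} l ij≢i′j′ =
    ≈-trans (matMul-unit i l l j i′ j′) (vanishes (i Fin.≟ i′) (j Fin.≟ j′))
    where
    vanishes : Dec (i ≡ i′) → Dec (j ≡ j′) → δ i i′ * (δ l l * δ j j′) ≈ 0#
    vanishes (no i≢i′) _ = ≈-trans (*-congʳ (≈-reflexive (δ-off i≢i′))) (zeroˡ _)
    vanishes (yes _) (no j≢j′) =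
      ≈-trans (*-congˡ (≈-trans (*-congˡ (≈-reflexive (δ-off j≢j′))) (zeroʳ _))) (zeroʳ _)
    vanishes (yes refl) (yes refl) = contradiction refl ij≢i′j′

  -- Gates are linear without constant terms, so zero operands give zero. As `Z` passes from a gate
  -- to its operands, it contains every wire on which one of its members depends, and only the
  -- inputs in `Z` have to vanish.
  wire-vanishes : ∀ {p} {X : Set} {s} (prog : Program X s) (x : X → Carrier) (Z : Wire X s → Set p) →
    (∀ g w → w ∈ operandsOf prog g → Z (inj₂ g) → Z w) →
    (∀ i → Z (inj₁ i) → x i ≈ 0#) →
    ∀ w → Z w → wireValue prog x w ≈ 0#
  wire-vanishes prog x Z closed x≈0 (inj₁ i) z = x≈0 i z
  wire-vanishes (prog ▸ g) x Z closed x≈0 (inj₂ zero) z = gate-vanishes g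
    (λ w w∈g → earlier w (closed zero _ (∈-map⁺ _ w∈g) z))
    where
    earlier : ∀ w → Z (Sum.map₂ suc w) → wireValue prog x w ≈ 0#
    earlier = wire-vanishes prog x (Z ∘ Sum.map₂ suc)
      (λ h w w∈h → closed (suc h) _ (∈-map⁺ _ w∈h)) x≈0
    gate-vanishes : ∀ h → (∀ w → w ∈ gateOperands h → wireValue prog x w ≈ 0#) →
      gateValue (wireValue prog x) h ≈ 0#
    gate-vanishes (add v w) z = ≈-trans (+-cong (z v (here refl)) (z w (there (here refl)))) (+-identityˡ _)
    gate-vanishes (sub v w) z =
      ≈-trans (+-cong (z v (here refl)) (≈-trans (-‿cong (z w (there (here refl)))) -0#≈0#)) (+-identityˡ _)
    gate-vanishes (scale a w) z = ≈-trans (*-congˡ (z w (here refl))) (zeroʳ _)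
  wire-vanishes (prog ▸ g) x Z closed x≈0 (inj₂ (suc j)) z =
    wire-vanishes prog x (Z ∘ Sum.map₂ suc) (λ h w w∈h → closed (suc h) _ (∈-map⁺ _ w∈h)) x≈0 (inj₂ j) z

  module _ {n₀ m : ℕ} (alg : BilinearAlgorithm n₀ m) (connected : Dec₁Connected alg) where

    open BilinearAlgorithm alg

    -- Over the trivial ring every coefficient is zero, so the base decoding graph has no edges and
    -- cannot connect two distinct outputs.
    connected⇒nontrivial : ∀ {IJ IJ′ : Entry n₀} → IJ ≢ IJ′ → ¬ (1# ≈ 0#)
    connected⇒nontrivial {IJ} {IJ′} IJ≢IJ′ 1≈0 = IJ≢IJ′ (output-injective
      (gfold isEquivalence id no-edge (connected (output IJ) (output IJ′))))
      where
      trivial : ∀ a → a ≈ 0#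
      trivial a = ≈-trans (≈-sym (*-identityˡ a)) (≈-trans (*-congʳ 1≈0) (zeroˡ a))
      no-edge : ∀ {u v} → Dec₁Edge alg u v → u ≡ v
      no-edge (edge coeff≉0) = contradiction (trivial _) coeff≉0
      output-injective : ∀ {IJ IJ′} → output {n₀} {m} IJ ≡ output IJ′ → IJ ≡ IJ′
      output-injective refl = refl

    module _ (ev : Evaluation alg) where

      open Evaluation ev
      private module DecC = LinearCircuit decC

      computed-product : ∀ A B IJ →
        DecC.value (λ r → L r A * L′ r B) IJ ≈ matMul A B IJ
      computed-product A B IJ = ≈-trans (decC-computes _ IJ) (correct A B IJ)

      -- The product E_il E_lj = E_ij has entry 1 at `IJ` and 0 at `IJ′`; a shared output wire would
      -- have to carry both values.
      out-injective : ¬ (1# ≈ 0#) → Fin n₀ → ∀ {IJ IJ′} → DecC.out IJ ≡ DecC.out IJ′ → IJ ≡ IJ′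
      out-injective 1≉0 l {IJ@(i , j)} {IJ′} out≡ with ≡-dec Fin._≟_ Fin._≟_ IJ IJ′
      ... | yes IJ≡IJ′ = IJ≡IJ′
      ... | no IJ≢IJ′  = contradiction 1≈0 1≉0
        where
        1≈0 : 1# ≈ 0#
        1≈0 = begin
          1#                                                    ≈⟨ matMul-unit-diag i l j ⟨
          matMul (unit i l) (unit l j) IJ                       ≈⟨ computed-product _ _ IJ ⟨
          wireValue DecC.program _ (DecC.out IJ)                ≡⟨ cong (wireValue DecC.program _) out≡ ⟩
          wireValue DecC.program _ (DecC.out IJ′)               ≈⟨ computed-product _ _ IJ′ ⟩
          matMul (unit i l) (unit l j) IJ′                      ≈⟨ matMul-unit-outer l IJ≢IJ′ ⟩
          0#                                                    ∎

      -- A single product has rank one as a bilinear form, an entry of AB has rank n₀.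
      out-isGate : ¬ (1# ≈ 0#) → ∀ {l l′ : Fin n₀} → l ≢ l′ →
        ∀ IJ → ∃[ g ] DecC.out IJ ≡ inj₂ g
      out-isGate 1≉0 {l} {l′} l≢l′ IJ@(i , j) with DecC.out IJ in out≡
      ... | inj₂ g = g , refl
      ... | inj₁ r = contradiction 1≈0 1≉0
        where
        α β : Fin n₀ → Carrier
        α x = L r (unit i x)
        β y = L′ r (unit y j)
        αβ : ∀ x y → α x * β y ≈ matMul (unit i x) (unit y j) IJ
        αβ x y = ≈-trans
          (≈-reflexive (cong (wireValue DecC.program (λ r → L r (unit i x) * L′ r (unit y j))) (sym out≡)))
          (computed-product _ _ IJ)
        diag : ∀ x → α x * β x ≈ 1#
        diag x = ≈-trans (αβ x x) (matMul-unit-diag i x j)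
        -- If the output wire were a product, `α x * β y` would be the identity matrix in `x` and
        -- `y`. Its 2 by 2 minor at `l`, `l′` would be 1, whereas rank one forces the diagonal
        -- product to equal the off-diagonal one, which is 0.
        1≈0 : 1# ≈ 0#
        1≈0 = begin
          1#                          ≈⟨ *-identityˡ 1# ⟨
          1# * 1#                     ≈⟨ *-cong (diag l) (diag l′) ⟨
          α l * β l * (α l′ * β l′)   ≈⟨ *-congˡ (*-comm _ _) ⟩
          α l * β l * (β l′ * α l′)   ≈⟨ *-assoc _ _ _ ⟩
          α l * (β l * (β l′ * α l′)) ≈⟨ *-congˡ (*-assoc _ _ _) ⟨
          α l * (β l * β l′ * α l′)   ≈⟨ *-congˡ (*-congʳ (*-comm _ _)) ⟩
          α l * (β l′ * β l * α l′)   ≈⟨ *-congˡ (*-assoc _ _ _) ⟩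
          α l * (β l′ * (β l * α l′)) ≈⟨ *-assoc _ _ _ ⟨
          α l * β l′ * (β l * α l′)   ≈⟨ *-congʳ (≈-trans (αβ l l′) (matMul-unit-inner i j l≢l′)) ⟩
          0# * (β l * α l′)           ≈⟨ zeroˡ _ ⟩
          0#                          ∎

      wireOf : Dec₁Vertex n₀ m → Wire (Fin m) DecC.gates
      wireOf (product r) = inj₁ r
      wireOf (output IJ) = DecC.out IJ

      -- All wires on which an output depends carry the label of that output. If the label of
      -- product `r` differed, the input `δ r` would give the value 0 at the output; but this value
      -- is the coefficient of product `r`, which is nonzero along an edge. Connectivity spreads the
      -- agreement from edges to all pairs of vertices.
      labelling-constant : (Z : Wire (Fin m) DecC.gates → Bool) →
        (∀ g w → w ∈ operandsOf DecC.program g → Z w ≡ Z (inj₂ g)) →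
        ∀ u v → Z (wireOf u) ≡ Z (wireOf v)
      labelling-constant Z agree u v =
        gfold isEquivalence (Z ∘ wireOf) edge-agrees (connected u v)
        where
        edge-agrees : ∀ {u v} → Dec₁Edge alg u v → Z (wireOf u) ≡ Z (wireOf v)
        edge-agrees {output IJ} {product r} (edge coeff≉0) with Z (DecC.out IJ) Bool.≟ Z (inj₁ r)
        ... | yes eq = eq
        ... | no neq = contradiction coeff≈0 coeff≉0
          where
          δ-vanishes : ∀ r′ → Z (inj₁ r′) ≡ Z (DecC.out IJ) → δ r r′ ≈ 0#
          δ-vanishes r′ eq = ≈-reflexive (δ-off {i = r} {r′} λ { refl → neq (sym eq) })
          coeff≈0 : coeffC IJ r ≈ 0#
          coeff≈0 = begin
            coeffC IJ r               ≈⟨ linComb-δ (coeffC IJ) r ⟨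
            linComb (coeffC IJ) (δ r) ≈⟨ decC-computes (δ r) IJ ⟨
            DecC.value (δ r) IJ       ≈⟨ wire-vanishes DecC.program (δ r) (λ w → Z w ≡ Z (DecC.out IJ))
                                           (λ g w w∈g eq → trans (agree g w w∈g) eq) δ-vanishes (DecC.out IJ) refl ⟩
            0#                        ∎

-- Finite sums over lists and the number of matrix entries

open import Data.Nat.Base using (_+_; _*_; _⊓_; z≤n; s≤s)

private variable
  A B C : Set

∑ : List A → (A → ℕ) → ℕ
∑ xs f = sum (map f xs)

open CommutativeSemigroup ℕ.+-commutativeSemigroup using () renaming (interchange to +-interchange)
open CommutativeSemigroup ℕ.*-commutativeSemigroup using () renaming (interchange to *-interchange)

∑-+ : ∀ (xs : List A) f g → ∑ xs (λ x → f x + g x) ≡ ∑ xs f + ∑ xs g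
∑-+ []       f g = refl
∑-+ (x ∷ xs) f g = trans (cong (f x + g x +_) (∑-+ xs f g))
  (+-interchange (f x) (g x) (∑ xs f) (∑ xs g))

∑-cong : ∀ (xs : List A) {f g} → (∀ x → f x ≡ g x) → ∑ xs f ≡ ∑ xs g
∑-cong xs f≗g = cong sum (map-cong f≗g xs)

∑-mono : ∀ (xs : List A) {f g} → (∀ x → f x ≤ g x) → ∑ xs f ≤ ∑ xs g
∑-mono []       f≤g = z≤n
∑-mono (x ∷ xs) f≤g = ℕ.+-mono-≤ (f≤g x) (∑-mono xs f≤g)

∑-const : ∀ (xs : List A) c → ∑ xs (λ _ → c) ≡ length xs * c
∑-const []       c = refl
∑-const (x ∷ xs) c = cong (c +_) (∑-const xs c)

∑-*ˡ : ∀ (xs : List A) c f → ∑ xs (λ x → c * f x) ≡ c * ∑ xs f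
∑-*ˡ []       c f = sym (ℕ.*-zeroʳ c)
∑-*ˡ (x ∷ xs) c f =
  trans (cong (c * f x +_) (∑-*ˡ xs c f)) (sym (ℕ.*-distribˡ-+ c (f x) (∑ xs f)))

∑-++ : ∀ (xs ys : List A) f → ∑ (xs ++ ys) f ≡ ∑ xs f + ∑ ys f
∑-++ xs ys f = trans (cong sum (map-++ f xs ys)) (sum-++ (map f xs) (map f ys))

∑-map : ∀ (g : A → B) xs f → ∑ (map g xs) f ≡ ∑ xs (f ∘ g)
∑-map g xs f = cong sum (sym (map-∘ xs))

∑-product : ∀ (f : A → B → C) xs ys h →
  ∑ (cartesianProductWith f xs ys) h ≡ ∑ xs λ x → ∑ ys λ y → h (f x y)
∑-product f []       ys h = refl
∑-product f (x ∷ xs) ys h =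
  trans (∑-++ (map (f x) ys) _ h) (cong₂ _+_ (∑-map (f x) ys h) (∑-product f xs ys h))

∑-comm : ∀ (xs : List A) (ys : List B) (f : A → B → ℕ) →
  ∑ xs (λ x → ∑ ys (f x)) ≡ ∑ ys (λ y → ∑ xs (λ x → f x y))
∑-comm []       ys f = sym (trans (∑-const ys 0) (ℕ.*-zeroʳ (length ys)))
∑-comm (x ∷ xs) ys f = trans (cong (∑ ys (f x) +_) (∑-comm xs ys f))
  (sym (∑-+ ys (f x) (λ y → ∑ xs (λ x′ → f x′ y))))

≤-∑ : ∀ {xs : List A} {x} f → x ∈ xs → f x ≤ ∑ xs f
≤-∑ f (here refl)           = ℕ.m≤m+n _ _
≤-∑ f (there {x = y} x∈xs) = ℕ.≤-trans (≤-∑ f x∈xs) (ℕ.m≤n+m _ (f y))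

[_]₀₁ : Bool → ℕ
[ b ]₀₁ = if b then 1 else 0

[]₀₁≤1 : ∀ b → [ b ]₀₁ ≤ 1
[]₀₁≤1 false = z≤n
[]₀₁≤1 true  = s≤s z≤n

^-distribʳ-* : ∀ a b n → (a * b) ^ n ≡ a ^ n * b ^ n
^-distribʳ-* a b zero    = refl
^-distribʳ-* a b (suc n) = trans (cong (a * b *_) (^-distribʳ-* a b n))
  (*-interchange a b (a ^ n) (b ^ n))

allFin-length : ∀ n → length (allFin n) ≡ n
allFin-length n = length-tabulate {n = n} id

length-product : ∀ (f : A → B → C) xs ys →
  length (cartesianProductWith f xs ys) ≡ length xs * length ys
length-product f xs ys = begin
  length (cartesianProductWith f xs ys)              ≡⟨ ℕ.*-identityʳ _ ⟨
  length (cartesianProductWith f xs ys) * 1          ≡⟨ ∑-const (cartesianProductWith f xs ys) 1 ⟨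
  ∑ (cartesianProductWith f xs ys) (λ _ → 1)         ≡⟨ ∑-product f xs ys _ ⟩
  ∑ xs (λ _ → ∑ ys (λ _ → 1))                        ≡⟨ ∑-const xs _ ⟩
  length xs * ∑ ys (λ _ → 1)                         ≡⟨ cong (length xs *_) (∑-const ys 1) ⟩
  length xs * (length ys * 1)                        ≡⟨ cong (length xs *_) (ℕ.*-identityʳ _) ⟩
  length xs * length ys                              ∎
  where open ≡-Reasoning

blocks : ∀ n → List (Entry n)
blocks n = cartesianProduct (allFin n) (allFin n)

length-blocks : ∀ n → length (blocks n) ≡ n ^ 2
length-blocks n = trans (length-product _,_ (allFin n) (allFin n))
  (cong₂ _*_ (allFin-length n) (trans (allFin-length n) (sym (ℕ.*-identityʳ n))))

-- The decoding graph of the recursive algorithm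

module Decoding {c ℓ : Level} {R : CommutativeRing c ℓ} {n₀ m : ℕ}
                {alg : Bilinear.BilinearAlgorithm R n₀ m}
                (ev : Bilinear.Evaluation R alg) where

  open Bilinear R
  open Recursion ev
  private module DecC = LinearCircuit (Evaluation.decC ev)

  -- Listed block by block, so that sums over the entries split along the recursion.
  entries : ∀ k → List (Entry (n₀ ^ k))
  entries zero    = (zero , zero) ∷ []
  entries (suc k) = cartesianProductWith inBlock (blocks n₀) (entries k)

  length-entries : ∀ k → length (entries k) ≡ (n₀ ^ k) ^ 2
  length-entries zero    = refl
  length-entries (suc k) = begin
    length (entries (suc k))             ≡⟨ length-product inBlock (blocks n₀) (entries k) ⟩
    length (blocks n₀) * length (entries k) ≡⟨ cong₂ _*_ (length-blocks n₀) (length-entries k) ⟩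
    n₀ ^ 2 * (n₀ ^ k) ^ 2                ≡⟨ ^-distribʳ-* n₀ (n₀ ^ k) 2 ⟨
    (n₀ * n₀ ^ k) ^ 2                    ∎
    where open ≡-Reasoning

  mutual
    -- The vertex returned by `result` is always an operation and does not depend on the arguments
    -- `a` and `b`, so it can be described inside `Op k`.
    resultOp : ∀ k → Entry (n₀ ^ k) → Op k
    resultOp zero    _  = mult
    resultOp (suc k) ij = let (IJ , e) = splitEntry n₀ (n₀ ^ k) ij in wireOp {k} e (DecC.out IJ)

    wireOp : ∀ {k} → Entry (n₀ ^ k) → Wire (Fin m) DecC.gates → Op (suc k)
    wireOp {k} e (inj₁ r) = call r (resultOp k e)
    wireOp {k} e (inj₂ g) = gateC {k} g e

  splitEntry-inBlock : ∀ {n} IJ (e : Entry n) → splitEntry n₀ n (inBlock IJ e) ≡ (IJ , e)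
  splitEntry-inBlock {n} (I , J) (i , j) =
    cong₂ (λ (I , i) (J , j) → (I , J) , (i , j))
      (Fin.remQuot-combine {n₀} {n} I i) (Fin.remQuot-combine {n₀} {n} J j)

  resultOp-inBlock : ∀ {k} IJ e → resultOp (suc k) (inBlock IJ e) ≡ wireOp {k} e (DecC.out IJ)
  resultOp-inBlock {k} IJ e =
    cong (λ (IJ , e) → wireOp {k} e (DecC.out IJ)) (splitEntry-inBlock {n₀ ^ k} IJ e)

  -- The edges into decoding gates at all levels of the recursion: `top e` gives those of the
  -- circuit run for block entry `e`, `below r` those inside call `r`.
  data DecEdge : ∀ {k} → Op k → Op k → Set where
    top   : ∀ {k} (e : Entry (n₀ ^ k)) {w g} → w ∈ operandsOf DecC.program g →
            DecEdge (wireOp {k} e w) (gateC g e)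
    below : ∀ {k} r {o o′ : Op k} → DecEdge o o′ → DecEdge (call r o) (call r o′)

  module _ {V : Set} where

    mutual
      result-resultOp : ∀ k (a b : Entry (n₀ ^ k) → V) emb e →
        result k a b emb e ≡ emb (resultOp k e)
      result-resultOp zero    a b emb e = refl
      result-resultOp (suc k) a b emb ij =
        argC-wireOp k a b emb _ (DecC.out (proj₁ (splitEntry n₀ (n₀ ^ k) ij)))

      argC-wireOp : ∀ k (a b : Entry (n₀ ^ suc k) → V) emb e w →
        argC k a b emb e w ≡ emb (wireOp {k} e w)
      argC-wireOp k a b emb e (inj₁ r) =
        result-resultOp k (subA a emb r) (subB b emb r) (emb ∘ call r) e
      argC-wireOp k a b emb e (inj₂ g) = refl

    DecEdge⇒operand : ∀ {k} (a b : Entry (n₀ ^ k) → V) emb {o o′} →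
      DecEdge o o′ → emb o ∈ opOperands k a b emb o′
    DecEdge⇒operand {suc k} a b emb (top e {w} {g} w∈g) =
      subst (_∈ opOperands (suc k) a b emb (gateC g e)) (argC-wireOp k a b emb e w)
        (∈-map⁺ (argC k a b emb e) w∈g)
    DecEdge⇒operand {suc k} a b emb (below r d) = DecEdge⇒operand {k} _ _ (emb ∘ call r) d

  -- The wires of all copies of Dec₁: products are the results of calls, which enter a
  -- copy.  A vertex can be both a product of one copy and a gate of another.
  results products gates : ∀ k → List (Op k)
  results k = map (resultOp k) (entries k)
  products zero    = []
  products (suc k) = cartesianProductWith call (allFin m) (products k ++ results k)
  gates zero    = []
  gates (suc k) = cartesianProductWith call (allFin m) (gates k)
               ++ cartesianProductWith gateC (allFin DecC.gates) (entries k)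

  -- A vertex in both lists counts twice, so that every copy is charged for all of its wires.
  load : ∀ k → (Op k → ℕ) → ℕ
  load k mem = ∑ (products k) mem + ∑ (gates k) mem

  copyLoad : ∀ {k} → (Op (suc k) → ℕ) → Entry (n₀ ^ k) → ℕ
  copyLoad {k} mem e = ∑ (allFin m) (λ r → mem (wireOp {k} e (inj₁ r)))
                 + ∑ (allFin DecC.gates) (λ g → mem (wireOp {k} e (inj₂ g)))

  -- For each call, `products (suc k)` holds the results of the call beside the products inside it.
  -- The results are assigned to the top-level copies that they enter, and exchanging the sums
  -- groups them, like the top-level gates, by block entry.
  load-suc : ∀ k mem → load (suc k) mem ≡
    ∑ (allFin m) (λ r → load k (mem ∘ call r)) + ∑ (entries k) (copyLoad mem)
  load-suc k mem = begin
    load (suc k) mem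
      ≡⟨ cong₂ _+_ products-split gates-split ⟩
    ∑ Ms (λ r → ∑ (products k) (mem ∘ call r)) + ∑ (entries k) callsLoad
      + (∑ Ms (λ r → ∑ (gates k) (mem ∘ call r)) + ∑ (entries k) gatesLoad)
      ≡⟨ +-interchange (∑ Ms (λ r → ∑ (products k) (mem ∘ call r))) (∑ (entries k) callsLoad)
           (∑ Ms (λ r → ∑ (gates k) (mem ∘ call r))) (∑ (entries k) gatesLoad) ⟩
    ∑ Ms (λ r → ∑ (products k) (mem ∘ call r)) + ∑ Ms (λ r → ∑ (gates k) (mem ∘ call r))
      + (∑ (entries k) callsLoad + ∑ (entries k) gatesLoad)
      ≡⟨ cong₂ _+_ (∑-+ Ms _ _) (∑-+ (entries k) _ _) ⟨
    ∑ Ms (λ r → load k (mem ∘ call r)) + ∑ (entries k) (copyLoad mem) ∎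
    where
    open ≡-Reasoning
    Ms = allFin m
    callsLoad gatesLoad : Entry (n₀ ^ k) → ℕ
    callsLoad e = ∑ Ms (λ r → mem (wireOp {k} e (inj₁ r)))
    gatesLoad e = ∑ (allFin DecC.gates) (λ g → mem (wireOp {k} e (inj₂ g)))
    products-split : ∑ (products (suc k)) mem ≡
      ∑ Ms (λ r → ∑ (products k) (mem ∘ call r)) + ∑ (entries k) callsLoad
    products-split = begin
      ∑ (products (suc k)) mem
        ≡⟨ ∑-product call Ms (products k ++ results k) mem ⟩
      ∑ Ms (λ r → ∑ (products k ++ results k) (mem ∘ call r))
        ≡⟨ ∑-cong Ms (λ r → ∑-++ (products k) (results k) (mem ∘ call r)) ⟩
      ∑ Ms (λ r → ∑ (products k) (mem ∘ call r) + ∑ (results k) (mem ∘ call r))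
        ≡⟨ ∑-+ Ms _ _ ⟩
      ∑ Ms (λ r → ∑ (products k) (mem ∘ call r)) + ∑ Ms (λ r → ∑ (results k) (mem ∘ call r))
        ≡⟨ cong (∑ Ms (λ r → ∑ (products k) (mem ∘ call r)) +_)
             (trans (∑-cong Ms (λ r → ∑-map (resultOp k) (entries k) (mem ∘ call r)))
                    (∑-comm Ms (entries k) (λ r e → mem (wireOp {k} e (inj₁ r))))) ⟩
      ∑ Ms (λ r → ∑ (products k) (mem ∘ call r)) + ∑ (entries k) callsLoad ∎
    gates-split : ∑ (gates (suc k)) mem ≡
      ∑ Ms (λ r → ∑ (gates k) (mem ∘ call r)) + ∑ (entries k) gatesLoad
    gates-split = begin
      ∑ (gates (suc k)) mem
        ≡⟨ ∑-++ (cartesianProductWith call Ms (gates k)) _ mem ⟩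
      ∑ (cartesianProductWith call Ms (gates k)) mem
        + ∑ (cartesianProductWith gateC (allFin DecC.gates) (entries k)) mem
        ≡⟨ cong₂ _+_ (∑-product call Ms (gates k) mem)
             (trans (∑-product gateC (allFin DecC.gates) (entries k) mem)
                    (∑-comm (allFin DecC.gates) (entries k) (λ g e → mem (gateC g e)))) ⟩
      ∑ Ms (λ r → ∑ (gates k) (mem ∘ call r)) + ∑ (entries k) gatesLoad ∎

  -- mem counts the occurrences of a result in fast and slow memory.
  Consistent : ∀ {k} → (Op k → Bool) → (Op k → ℕ) → Set
  Consistent computed mem = ∀ {o o′} → DecEdge o o′ →
    (computed o′ ≡ true → computed o ≡ true) ×
    (computed o ≡ true → computed o′ ≡ false → 1 ≤ mem o)

  -- Expansion of the decoding graph

  module Expansion (connected : Dec₁Connected alg) (IJ₀ : Entry n₀) (n₀²≤m : n₀ ^ 2 ≤ m) where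

    -- full (empty) indicates a copy that is wholly computed (uncomputed); both are 0
    -- if some wire of the copy is in memory.
    record Purity (μ : ℕ) (Ps : Fin m → Bool) (Os : Entry n₀ → Bool) : Set where
      field
        full empty  : ℕ
        full-below  : ∀ r → full ≤ [ Ps r ]₀₁
        empty-below : ∀ r → empty ≤ [ not (Ps r) ]₀₁
        full-above  : ∀ IJ → [ Os IJ ]₀₁ ≤ full + μ
        empty-above : ∀ IJ → [ not (Os IJ) ]₀₁ ≤ empty + μ

    module _ {k} (computed : Op (suc k) → Bool) (mem : Op (suc k) → ℕ)
             (consistent : Consistent computed mem) (e : Entry (n₀ ^ k)) where

      private
        Z : Wire (Fin m) DecC.gates → Bool
        Z w = computed (wireOp {k} e w)

        mem≤copyLoad : ∀ w → mem (wireOp {k} e w) ≤ copyLoad mem e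
        mem≤copyLoad (inj₁ r) = ℕ.≤-trans
          (≤-∑ (λ r → mem (wireOp {k} e (inj₁ r))) (∈-allFin r)) (ℕ.m≤m+n _ _)
        mem≤copyLoad (inj₂ g) = ℕ.≤-trans
          (≤-∑ (λ g → mem (wireOp {k} e (inj₂ g))) (∈-allFin g)) (ℕ.m≤n+m _ _)

        agree : copyLoad mem e ≡ 0 → ∀ g w → w ∈ operandsOf DecC.program g → Z w ≡ Z (inj₂ g)
        agree μ≡0 g w w∈g with Z w | Z (inj₂ g) | consistent (top {k} e w∈g)
        ... | true  | true  | _        = refl
        ... | false | false | _        = refl
        ... | false | true  | closed , _ with () ← closed refl
        ... | true  | false | _ , held with () ←
          ℕ.≤-trans (held refl refl) (ℕ.≤-trans (mem≤copyLoad w) (ℕ.≤-reflexive μ≡0))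

      -- With load 0, no computed wire feeds an uncomputed gate, and consistency excludes the
      -- converse; so gates agree with their operands and `labelling-constant` applies. With
      -- positive load, the slack alone bounds every indicator.
      purity : Purity (copyLoad mem e) (Z ∘ inj₁) (Z ∘ DecC.out)
      purity with copyLoad mem e | agree
      ... | zero | agree = record
        -- All products and outputs of the copy have the same label, so the output `IJ₀` can stand
        -- for the copy.
        { full        = [ Z (DecC.out IJ₀) ]₀₁
        ; empty       = [ not (Z (DecC.out IJ₀)) ]₀₁
        ; full-below  = λ r → ℕ.≤-reflexive (cong [_]₀₁ (constant (output IJ₀) (product r)))
        ; empty-below = λ r → ℕ.≤-reflexive (cong ([_]₀₁ ∘ not) (constant (output IJ₀) (product r)))
        ; full-above  = λ IJ → ℕ.≤-trans
            (ℕ.≤-reflexive (cong [_]₀₁ (constant (output IJ) (output IJ₀)))) (ℕ.m≤m+n _ 0)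
        ; empty-above = λ IJ → ℕ.≤-trans
            (ℕ.≤-reflexive (cong ([_]₀₁ ∘ not) (constant (output IJ) (output IJ₀)))) (ℕ.m≤m+n _ 0)
        }
        where constant = RingFacts.labelling-constant R alg connected ev Z (agree refl)
      ... | suc μ | _ = record
        { full = 0 ; empty = 0
        ; full-below = λ _ → z≤n ; empty-below = λ _ → z≤n
        ; full-above  = λ IJ → ℕ.≤-trans ([]₀₁≤1 _) (s≤s z≤n)
        ; empty-above = λ IJ → ℕ.≤-trans ([]₀₁≤1 _) (s≤s z≤n)
        }

    done missing : ∀ k → (Op k → Bool) → ℕ
    done    k computed = ∑ (entries k) (λ e → [ computed (resultOp k e) ]₀₁)
    missing k computed = ∑ (entries k) (λ e → [ not (computed (resultOp k e)) ]₀₁)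

    -- Induction on `k`. With `P` full copies, `Q` empty ones and load `U` on the top-level copies,
    -- the computed outputs number at most `N * (P + U)` and the missing ones at most `N * (Q + U)`.
    -- Every subcall has at least `P` computed and `Q` missing results, so by induction its load is
    -- at least `P ⊓ Q` divided by `N`.
    expansion : ∀ k computed mem → Consistent {k} computed mem →
      done k computed ⊓ missing k computed ≤ n₀ ^ 2 * load k mem
    -- A single output is either computed or missing, so the minimum of the two counts is 0.
    expansion zero computed mem consistent with computed mult
    ... | true  = z≤n
    ... | false = z≤n
    expansion (suc k) computed mem consistent = begin
      done (suc k) computed ⊓ missing (suc k) computed
        ≤⟨ ℕ.⊓-mono-≤ (lift-bound [_]₀₁ full full-above) (lift-bound ([_]₀₁ ∘ not) empty empty-above) ⟩
      (N * (P + U)) ⊓ (N * (Q + U))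
        ≡⟨ ℕ.*-distribˡ-⊓ N (P + U) (Q + U) ⟨
      N * ((P + U) ⊓ (Q + U))
        ≡⟨ cong (N *_) (ℕ.+-distribʳ-⊓ U P Q) ⟨
      N * (P ⊓ Q + U)
        ≡⟨ ℕ.*-distribˡ-+ N (P ⊓ Q) U ⟩
      N * (P ⊓ Q) + N * U
        ≤⟨ ℕ.+-monoˡ-≤ (N * U) subcalls ⟩
      N * ∑ (allFin m) (λ r → load k (mem ∘ call r)) + N * U
        ≡⟨ ℕ.*-distribˡ-+ N _ U ⟨
      N * (∑ (allFin m) (λ r → load k (mem ∘ call r)) + U)
        ≡⟨ cong (N *_) (load-suc k mem) ⟨
      N * load (suc k) mem ∎
      where
      open ℕ.≤-Reasoning
      module Pure e = Purity (purity computed mem consistent e)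
      open Pure using (full; empty; full-below; empty-below; full-above; empty-above)
      N = n₀ ^ 2
      P = ∑ (entries k) full
      Q = ∑ (entries k) empty
      U = ∑ (entries k) (copyLoad mem)
      -- `φ` is the indicator of computed or of uncomputed. Each block entry `e` occurs in `N`
      -- outputs, one per block, all decoded by the same copy.
      lift-bound : ∀ (φ : Bool → ℕ) (f : Entry (n₀ ^ k) → ℕ) →
        (∀ e IJ → φ (computed (wireOp {k} e (DecC.out IJ))) ≤ f e + copyLoad mem e) →
        ∑ (entries (suc k)) (λ ij → φ (computed (resultOp (suc k) ij))) ≤ N * (∑ (entries k) f + U)
      lift-bound φ f above = begin
        ∑ (entries (suc k)) (λ ij → φ (computed (resultOp (suc k) ij)))
          ≡⟨ ∑-product inBlock (blocks n₀) (entries k) _ ⟩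
        ∑ (blocks n₀) (λ IJ → ∑ (entries k) (λ e → φ (computed (resultOp (suc k) (inBlock IJ e)))))
          ≤⟨ ∑-mono (blocks n₀) (λ IJ → ∑-mono (entries k) (λ e →
               subst (λ o → φ (computed o) ≤ f e + copyLoad mem e) (sym (resultOp-inBlock IJ e)) (above e IJ))) ⟩
        ∑ (blocks n₀) (λ IJ → ∑ (entries k) (λ e → f e + copyLoad mem e))
          ≡⟨ ∑-const (blocks n₀) _ ⟩
        length (blocks n₀) * ∑ (entries k) (λ e → f e + copyLoad mem e)
          ≡⟨ cong₂ _*_ (length-blocks n₀) (∑-+ (entries k) f (copyLoad mem)) ⟩
        N * (∑ (entries k) f + U) ∎
      subcall : ∀ r → P ⊓ Q ≤ N * load k (mem ∘ call r)
      subcall r = ℕ.≤-trans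
        (ℕ.⊓-mono-≤ (∑-mono (entries k) (λ e → full-below e r)) (∑-mono (entries k) (λ e → empty-below e r)))
        (expansion k (computed ∘ call r) (mem ∘ call r) (consistent ∘ below r))
      -- The loads of the `m` subcalls add up, and `n₀ ^ 2 ≤ m` makes their number pay for the
      -- factor `N`; thus the constant does not deteriorate with the depth.
      subcalls : N * (P ⊓ Q) ≤ N * ∑ (allFin m) (λ r → load k (mem ∘ call r))
      subcalls = begin
        N * (P ⊓ Q)                     ≤⟨ ℕ.*-monoˡ-≤ (P ⊓ Q) n₀²≤m ⟩
        m * (P ⊓ Q)                     ≡⟨ cong (_* (P ⊓ Q)) (allFin-length m) ⟨
        length (allFin m) * (P ⊓ Q)     ≡⟨ ∑-const (allFin m) (P ⊓ Q) ⟨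
        ∑ (allFin m) (λ _ → P ⊓ Q)      ≤⟨ ∑-mono (allFin m) subcall ⟩
        ∑ (allFin m) (λ r → N * load k (mem ∘ call r)) ≡⟨ ∑-*ˡ (allFin m) N _ ⟩
        N * ∑ (allFin m) (λ r → load k (mem ∘ call r)) ∎

-- Runs in the two-level memory

module Memory (G : ComputationGraph) (M : ℕ)
              (_≟_ : DecidableEquality (ComputationGraph.Operation G)) where

  open ComputationGraph G
  open TwoLevelMemory G M
  open State
  open DecMembership _≟_ using (_∈?_)

  isOp : Vertex → ℕ
  isOp (inj₁ _) = 0
  isOp (inj₂ _) = 1

  hit : Operation → Vertex → ℕ
  hit o (inj₁ _)  = 0
  hit o (inj₂ o′) = [ does (o ≟ o′) ]₀₁

  occ : List Vertex → Operation → ℕ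
  occ L o = ∑ L (hit o)

  ∑-indicator-absent : ∀ {o U} → All (o ≢_) U → ∑ U (λ u → [ does (u ≟ o) ]₀₁) ≡ 0
  ∑-indicator-absent []                           = refl
  ∑-indicator-absent {o} (_∷_ {u} o≢u o∉U) with u ≟ o
  ... | yes u≡o = contradiction (sym u≡o) o≢u
  ... | no _    = ∑-indicator-absent o∉U

  ∑-indicator : ∀ {U} → Unique U → ∀ o → ∑ U (λ u → [ does (u ≟ o) ]₀₁) ≤ 1
  ∑-indicator []                       o = z≤n
  ∑-indicator (_∷_ {u} u∉U uniqueU) o with u ≟ o
  ... | yes refl = s≤s (ℕ.≤-reflexive (∑-indicator-absent u∉U))
  ... | no _     = ∑-indicator uniqueU o

  -- After exchanging the sums, each word of `L` matches at most one member of the duplicate-free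
  -- list `U`.
  ∑-occ : ∀ {U} → Unique U → ∀ L → ∑ U (occ L) ≤ ∑ L isOp
  ∑-occ {U} uniqueU L = begin
    ∑ U (occ L)                     ≡⟨ ∑-comm U L hit ⟩
    ∑ L (λ v → ∑ U (λ u → hit u v)) ≤⟨ ∑-mono L ∑-hit ⟩
    ∑ L isOp                        ∎
    where
    open ℕ.≤-Reasoning
    ∑-hit : ∀ v → ∑ U (λ u → hit u v) ≤ isOp v
    ∑-hit (inj₁ _) = ℕ.≤-reflexive (trans (∑-const U 0) (ℕ.*-zeroʳ (length U)))
    ∑-hit (inj₂ o) = ∑-indicator uniqueU o

  ∑-isOp≤length : ∀ L → ∑ L isOp ≤ length L
  ∑-isOp≤length []           = z≤n
  ∑-isOp≤length (inj₁ _ ∷ L) = ℕ.m≤n⇒m≤1+n (∑-isOp≤length L)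
  ∑-isOp≤length (inj₂ _ ∷ L) = s≤s (∑-isOp≤length L)

  ∈⇒1≤occ : ∀ {o L} → inj₂ o ∈ L → 1 ≤ occ L o
  ∈⇒1≤occ {o} {L} o∈L = ℕ.≤-trans hit-self (≤-∑ (hit o) o∈L)
    where
    hit-self : 1 ≤ hit o (inj₂ o)
    hit-self with o ≟ o
    ... | yes _  = s≤s z≤n
    ... | no o≢o = contradiction refl o≢o

  record Invariant (s : State) : Set where
    field
      fast-fits     : length (fast s) ≤ M
      fast-computed : ∀ {p} → inj₂ p ∈ fast s → p ∈ computed s
      slow-computed : ∀ {p} → inj₂ p ∈ slow s → p ∈ computed s
      operands-computed : ∀ {p o} → o ∈ computed s → inj₂ p ∈ operands o → p ∈ computed s

  initial-invariant : Invariant initial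
  initial-invariant = record
    { fast-fits = z≤n
    ; fast-computed = λ ()
    ; slow-computed = λ p∈slow → contradiction (∈-map⁻ inj₁ p∈slow) λ { (_ , _ , ()) }
    ; operands-computed = λ ()
    }

  step-invariant : ∀ {s w s′} → s ⟶[ w ] s′ → Invariant s → Invariant s′
  step-invariant (read v∈slow kept⊆ fits) inv = record
    { fast-fits = fits
    ; fast-computed = λ { (here refl) → slow-computed v∈slow ; (there p∈kept) → fast-computed (kept⊆ p∈kept) }
    ; slow-computed = slow-computed
    ; operands-computed = operands-computed
    } where open Invariant inv
  step-invariant (write v∈fast) inv = record
    { fast-fits = fast-fits
    ; fast-computed = fast-computed
    ; slow-computed = λ { (here refl) → fast-computed v∈fast ; (there p∈slow) → slow-computed p∈slow }
    ; operands-computed = operands-computed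
    } where open Invariant inv
  step-invariant (compute ready _ kept⊆ fits) inv = record
    { fast-fits = fits
    ; fast-computed = λ { (here refl) → here refl ; (there p∈kept) → there (fast-computed (kept⊆ p∈kept)) }
    ; slow-computed = there ∘ slow-computed
    ; operands-computed = λ
        { (here refl) p∈o → there (fast-computed (All.lookup ready p∈o))
        ; (there o∈)  p∈o → there (operands-computed o∈ p∈o) }
    } where open Invariant inv

  step-computed : ∀ {s w s′} → s ⟶[ w ] s′ → ∀ {p} → p ∈ computed s → p ∈ computed s′
  step-computed (read _ _ _)      p∈ = p∈
  step-computed (write _)         p∈ = p∈
  step-computed (compute _ _ _ _) p∈ = there p∈

  -- Reads and writes only copy values that are in a memory already. Only `compute` creates one, and
  -- the ban on recomputation excludes this for a value computed before.
  step-holds : ∀ {s w s′} → s ⟶[ w ] s′ → ∀ {p} → p ∈ computed s →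
    inj₂ p ∈ fast s′ ⊎ inj₂ p ∈ slow s′ → inj₂ p ∈ fast s ⊎ inj₂ p ∈ slow s
  step-holds (read v∈slow _ _)     _  (inj₁ (here refl))    = inj₂ v∈slow
  step-holds (read _ kept⊆ _)      _  (inj₁ (there p∈kept)) = inj₁ (kept⊆ p∈kept)
  step-holds (read _ _ _)          _  (inj₂ p∈slow)         = inj₂ p∈slow
  step-holds (write _)             _  (inj₁ p∈fast)         = inj₁ p∈fast
  step-holds (write v∈fast)        _  (inj₂ (here refl))    = inj₁ v∈fast
  step-holds (write _)             _  (inj₂ (there p∈slow)) = inj₂ p∈slow
  step-holds (compute _ o∉ _ _)    p∈ (inj₁ (here refl))    = contradiction p∈ o∉
  step-holds (compute _ _ kept⊆ _) _  (inj₁ (there p∈kept)) = inj₁ (kept⊆ p∈kept)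
  step-holds (compute _ _ _ _)     _  (inj₂ p∈slow)         = inj₂ p∈slow

  -- Without recomputation a value that has left both memories never returns.
  still-held : ∀ {s w s′} → s ⟶*[ w ] s′ → ∀ {p o} → p ∈ computed s → o ∈ computed s′ →
    inj₂ p ∈ operands o → o ∈ computed s ⊎ (inj₂ p ∈ fast s ⊎ inj₂ p ∈ slow s)
  still-held ε _ o∈ _ = inj₁ o∈
  still-held (step ◅ run) p∈ o∈ p∈o with still-held run (step-computed step p∈) o∈ p∈o
  ... | inj₂ held = inj₂ (step-holds step p∈ held)
  ... | inj₁ o∈′ with step | o∈′
  ...   | read _ _ _          | o∈s       = inj₁ o∈s
  ...   | write _             | o∈s       = inj₁ o∈s
  ...   | compute ready _ _ _ | here refl = inj₂ (inj₁ (All.lookup ready p∈o))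
  ...   | compute _ _ _ _     | there o∈s = inj₁ o∈s

  step-slow : ∀ {s w s′} → s ⟶[ w ] s′ → ∀ o → occ (slow s) o ≤ occ (slow s′) o
  step-slow (read _ _ _)      o = ℕ.≤-refl
  step-slow (write {v = v} _) o = ℕ.m≤n+m _ (hit o v)
  step-slow (compute _ _ _ _) o = ℕ.≤-refl

  -- Slow memory never discards a word, so what it holds at an intermediate state is still counted
  -- at the end.
  run-slow : ∀ {s w s′} → s ⟶*[ w ] s′ → ∀ o → occ (slow s) o ≤ occ (slow s′) o
  run-slow ε            o = ℕ.≤-refl
  run-slow (step ◅ run) o = ℕ.≤-trans (step-slow step o) (run-slow run o)

  step-writes : ∀ {s w s′} → s ⟶[ w ] s′ → ∑ (slow s′) isOp ≤ w + ∑ (slow s) isOp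
  step-writes (read _ _ _)             = ℕ.m≤n+m _ 1
  step-writes (write {v = inj₁ _} _)   = ℕ.m≤n+m _ 1
  step-writes (write {v = inj₂ _} _)   = ℕ.≤-refl
  step-writes (compute _ _ _ _)        = ℕ.≤-refl

  -- Slow memory grows only by writes, one word each. As it starts with inputs alone, the results
  -- that it holds at the end bound the number of words from below.
  run-writes : ∀ {s w s′} → s ⟶*[ w ] s′ → ∑ (slow s′) isOp ≤ w + ∑ (slow s) isOp
  run-writes ε = ℕ.≤-refl
  run-writes {s} {s′ = s″} (_◅_ {s′ = s′} {w = w} {w′ = w′} step run) = begin
    ∑ (slow s″) isOp             ≤⟨ run-writes run ⟩
    w′ + ∑ (slow s′) isOp        ≤⟨ ℕ.+-monoʳ-≤ w′ (step-writes step) ⟩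
    w′ + (w + ∑ (slow s) isOp)   ≡⟨ ℕ.+-assoc w′ w _ ⟨
    w′ + w + ∑ (slow s) isOp     ≡⟨ cong (_+ ∑ (slow s) isOp) (ℕ.+-comm w′ w) ⟩
    w + w′ + ∑ (slow s) isOp     ∎
    where open ℕ.≤-Reasoning

  progress : List Operation → State → ℕ
  progress U s = ∑ U (λ o → [ does (o ∈? computed s) ]₀₁)

  step-progress : ∀ {U} → Unique U → ∀ {s w s′} → s ⟶[ w ] s′ → progress U s′ ≤ suc (progress U s)
  step-progress _ (read _ _ _) = ℕ.n≤1+n _
  step-progress _ (write _)    = ℕ.n≤1+n _
  step-progress {U} uniqueU {s} (compute {o = o} _ _ _ _) = begin
    ∑ U (λ u → [ does (u ∈? (o ∷ computed s)) ]₀₁)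
      ≤⟨ ∑-mono U (λ u → []₀₁-∨ (does (u ≟ o)) (does (u ∈? computed s))) ⟩
    ∑ U (λ u → [ does (u ≟ o) ]₀₁ + [ does (u ∈? computed s) ]₀₁)
      ≡⟨ ∑-+ U _ _ ⟩
    ∑ U (λ u → [ does (u ≟ o) ]₀₁) + progress U s
      ≤⟨ ℕ.+-monoˡ-≤ _ (∑-indicator uniqueU o) ⟩
    suc (progress U s) ∎
    where
    open ℕ.≤-Reasoning
    []₀₁-∨ : ∀ a b → [ a ∨ b ]₀₁ ≤ [ a ]₀₁ + [ b ]₀₁
    []₀₁-∨ false b = ℕ.≤-refl
    []₀₁-∨ true  b = s≤s z≤n

  -- A discrete intermediate value argument: each step raises the progress by at most one, so no
  -- value is skipped.
  visit : ∀ {U} → Unique U → ∀ K {s w s′} → s ⟶*[ w ] s′ → Invariant s →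
    progress U s ≤ K → K ≤ progress U s′ →
    ∃[ t ] ∃[ w′ ] (t ⟶*[ w′ ] s′) × Invariant t × progress U t ≡ K
  visit uniqueU K ε inv s≤K K≤s′ = _ , _ , ε , inv , ℕ.≤-antisym s≤K K≤s′
  visit {U} uniqueU K {s} (step ◅ run) inv s≤K K≤s′ with ℕ.m≤n⇒m<n∨m≡n s≤K
  ... | inj₂ s≡K = _ , _ , step ◅ run , inv , s≡K
  ... | inj₁ s<K = visit uniqueU K run (step-invariant step inv)
                     (ℕ.≤-trans (step-progress uniqueU step) s<K) K≤s′

  progress-initial : ∀ U → progress U initial ≡ 0
  progress-initial U = trans (∑-const U 0) (ℕ.*-zeroʳ (length U))

  module _ (impl : Implementation) where

    open Implementation impl

    finalOcc : Operation → ℕ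
    finalOcc = occ (slow final)

    progress-final : ∀ U → progress U final ≡ length U
    progress-final U = trans (∑-cong U (λ o → cong [_]₀₁ (dec-true (o ∈? computed final) (computes-all o))))
      (trans (∑-const U 1) (ℕ.*-identityʳ (length U)))

    ∑-finalOcc : ∀ {U} → Unique U → ∑ U finalOcc ≤ words
    ∑-finalOcc {U} uniqueU = begin
      ∑ U finalOcc                     ≤⟨ ∑-occ uniqueU (slow final) ⟩
      ∑ (slow final) isOp              ≤⟨ run-writes run ⟩
      words + ∑ (map inj₁ inputs) isOp ≡⟨ cong (words +_) no-writes ⟩
      words + 0                        ≡⟨ ℕ.+-identityʳ words ⟩
      words                            ∎
      where
      open ℕ.≤-Reasoning
      no-writes : ∑ (map inj₁ inputs) isOp ≡ 0
      no-writes = trans (∑-map inj₁ inputs isOp) (trans (∑-const inputs 0) (ℕ.*-zeroʳ (length inputs)))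

    -- The facts about the moment when exactly `K` operations of `U` are computed. This moment
    -- varies with the subproblem; `held-bound` refers all of them to the final slow memory, so that
    -- their bounds can be added.
    record Snapshot (U : List Operation) (K : ℕ) : Set where
      field
        computed?    : Operation → Bool
        fastOcc held : Operation → ℕ
        progressed   : ∑ U (λ o → [ computed? o ]₀₁) ≡ K
        closed       : ∀ {p o} → inj₂ p ∈ operands o → computed? o ≡ true → computed? p ≡ true
        retained     : ∀ {p o} → inj₂ p ∈ operands o →
                       computed? p ≡ true → computed? o ≡ false → 1 ≤ held p
        held-bound   : ∀ p → held p ≤ fastOcc p + finalOcc p
        ∑-fastOcc    : ∀ {W} → Unique W → ∑ W fastOcc ≤ M

    snapshot : ∀ {U} → Unique U → ∀ K → K ≤ length U → Snapshot U K
    snapshot {U} uniqueU K K≤U with visit uniqueU K run initial-invariant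
      (ℕ.≤-trans (ℕ.≤-reflexive (progress-initial U)) z≤n)
      (ℕ.≤-trans K≤U (ℕ.≤-reflexive (sym (progress-final U))))
    ... | t , _ , rest , inv , progressed = record
      { computed?  = λ o → does (o ∈? computed t)
      ; fastOcc    = occ (fast t)
      ; held       = λ p → occ (fast t) p + occ (slow t) p
      ; progressed = progressed
      ; closed     = λ {p} {o} p∈o o∈ → dec-true (p ∈? computed t)
                       (operands-computed (does⇒ (o ∈? computed t) o∈) p∈o)
      ; retained   = λ {p} {o} p∈o p∈ o∉ → retained p∈o
                       (does⇒ (p ∈? computed t) p∈) (does⇒¬ (o ∈? computed t) o∉)
      ; held-bound = λ p → ℕ.+-monoʳ-≤ (occ (fast t) p) (run-slow rest p)
      ; ∑-fastOcc  = λ uniqueW → ℕ.≤-trans (∑-occ uniqueW (fast t)) (ℕ.≤-trans (∑-isOp≤length (fast t)) fast-fits)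
      }
      where
      open Invariant inv
      does⇒ : ∀ {P : Set} (P? : Dec P) → does P? ≡ true → P
      does⇒ (yes p) _ = p
      does⇒¬ : ∀ {P : Set} (P? : Dec P) → does P? ≡ false → ¬ P
      does⇒¬ (no ¬p) _ = ¬p
      retained : ∀ {p o} → inj₂ p ∈ operands o → p ∈ computed t → o ∉ computed t →
        1 ≤ occ (fast t) p + occ (slow t) p
      -- Every operation is computed in the end, so `o` is still to come and will need `p`, which
      -- must therefore be in a memory now.
      retained p∈o p∈ o∉ with still-held rest p∈ (computes-all _) p∈o
      ... | inj₁ o∈          = contradiction o∈ o∉
      ... | inj₂ (inj₁ p∈fast) = ℕ.≤-trans (∈⇒1≤occ p∈fast) (ℕ.m≤m+n _ _)
      ... | inj₂ (inj₂ p∈slow) = ℕ.≤-trans (∈⇒1≤occ p∈slow) (ℕ.m≤n+m _ _)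

-- Distinctness of operations and subproblems addressed by call paths

module Paths {c ℓ : Level} {R : CommutativeRing c ℓ} {n₀ m : ℕ}
             {alg : Bilinear.BilinearAlgorithm R n₀ m}
             (ev : Bilinear.Evaluation R alg) where

  open Recursion ev
  open Decoding ev
  private module DecC = Bilinear.LinearCircuit (Bilinear.Evaluation.decC ev)

  _≟ᴼ_ : ∀ {k} → DecidableEquality (Op k)
  mult      ≟ᴼ mult        = yes refl
  gateA g e ≟ᴼ gateA g′ e′ =
    map′ (λ { (refl , refl) → refl }) (λ { refl → refl , refl }) (g Fin.≟ g′ ×-dec ≡-dec Fin._≟_ Fin._≟_ e e′)
  gateA _ _ ≟ᴼ gateB _ _   = no λ ()
  gateA _ _ ≟ᴼ call _ _    = no λ ()
  gateA _ _ ≟ᴼ gateC _ _   = no λ ()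
  gateB _ _ ≟ᴼ gateA _ _   = no λ ()
  gateB g e ≟ᴼ gateB g′ e′ =
    map′ (λ { (refl , refl) → refl }) (λ { refl → refl , refl }) (g Fin.≟ g′ ×-dec ≡-dec Fin._≟_ Fin._≟_ e e′)
  gateB _ _ ≟ᴼ call _ _    = no λ ()
  gateB _ _ ≟ᴼ gateC _ _   = no λ ()
  call _ _  ≟ᴼ gateA _ _   = no λ ()
  call _ _  ≟ᴼ gateB _ _   = no λ ()
  call r o  ≟ᴼ call r′ o′  =
    map′ (λ { (refl , refl) → refl }) (λ { refl → refl , refl }) (r Fin.≟ r′ ×-dec o ≟ᴼ o′)
  call _ _  ≟ᴼ gateC _ _   = no λ ()
  gateC _ _ ≟ᴼ gateA _ _   = no λ ()
  gateC _ _ ≟ᴼ gateB _ _   = no λ ()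
  gateC _ _ ≟ᴼ call _ _    = no λ ()
  gateC g e ≟ᴼ gateC g′ e′ =
    map′ (λ { (refl , refl) → refl }) (λ { refl → refl , refl }) (g Fin.≟ g′ ×-dec ≡-dec Fin._≟_ Fin._≟_ e e′)

  call-injective : ∀ {k} {r r′} {o o′ : Op k} → call r o ≡ call r′ o′ → r ≡ r′ × o ≡ o′
  call-injective refl = refl , refl

  gateC-injective : ∀ {k} {g g′} {e e′ : Entry (n₀ ^ k)} → gateC {k} g e ≡ gateC g′ e′ → g ≡ g′ × e ≡ e′
  gateC-injective refl = refl , refl

  call≢gateC : ∀ {k r g} {o : Op k} {e} → call r o ≢ gateC g e
  call≢gateC ()

  inBlock-injective : ∀ {n} {IJ IJ′} {e e′ : Entry n} →
    inBlock {n₀} IJ e ≡ inBlock IJ′ e′ → IJ ≡ IJ′ × e ≡ e′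
  inBlock-injective {n} {IJ} {IJ′} {e} {e′} eq = ,-injective
    (trans (sym (splitEntry-inBlock IJ e)) (trans (cong (splitEntry n₀ n) eq) (splitEntry-inBlock IJ′ e′)))

  splitEntry-injective : ∀ {n} {ij ij′ : Entry (n₀ * n)} →
    splitEntry n₀ n ij ≡ splitEntry n₀ n ij′ → ij ≡ ij′
  splitEntry-injective {n} {ij} {ij′} eq = trans (sym (glue ij))
    (trans (cong (λ (IJ , e) → inBlock IJ e) eq) (glue ij′))
    where
    glue : ∀ ij → (let (IJ , e) = splitEntry n₀ n ij in inBlock IJ e) ≡ ij
    glue (i , j) = cong₂ _,_ (Fin.combine-remQuot {n₀} n i) (Fin.combine-remQuot {n₀} n j)

  entries-unique : ∀ k → Unique (entries k)
  entries-unique zero    = [] ∷ []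
  entries-unique (suc k) = Unique.cartesianProductWith⁺ inBlock inBlock-injective
    (Unique.cartesianProduct⁺ (Unique.allFin⁺ n₀) (Unique.allFin⁺ n₀)) (entries-unique k)

  gates-unique : ∀ k → Unique (gates k)
  gates-unique zero    = []
  gates-unique (suc k) = Unique.++⁺
    (Unique.cartesianProductWith⁺ call call-injective (Unique.allFin⁺ m) (gates-unique k))
    (Unique.cartesianProductWith⁺ gateC gateC-injective (Unique.allFin⁺ DecC.gates) (entries-unique k))
    λ (v∈calls , v∈gates) →
      let _ , _ , _ , _ , v≡call = ∈-cartesianProductWith⁻ call (allFin m) (gates k) v∈calls
          _ , _ , _ , _ , v≡gate = ∈-cartesianProductWith⁻ gateC (allFin DecC.gates) (entries k) v∈gates
      in call≢gateC (trans (sym v≡call) v≡gate)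

  module _ (out-isGate : ∀ IJ → ∃[ g ] DecC.out IJ ≡ inj₂ g)
           (out-injective : ∀ {IJ IJ′} → DecC.out IJ ≡ DecC.out IJ′ → IJ ≡ IJ′) where

    resultOp-isGate : ∀ {k} (ij : Entry (n₀ ^ suc k)) → let (IJ , e) = splitEntry n₀ (n₀ ^ k) ij in
      resultOp (suc k) ij ≡ gateC (proj₁ (out-isGate IJ)) e
    resultOp-isGate {k} ij = let (IJ , e) = splitEntry n₀ (n₀ ^ k) ij in
      cong (wireOp {k} e) (proj₂ (out-isGate IJ))

    resultOp-injective : ∀ {k} {ij ij′ : Entry (n₀ ^ suc k)} →
      resultOp (suc k) ij ≡ resultOp (suc k) ij′ → ij ≡ ij′
    resultOp-injective {k} {ij} {ij′} eq =
      let g≡g′ , e≡e′ = gateC-injective {k}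
            (trans (sym (resultOp-isGate {k} ij)) (trans eq (resultOp-isGate {k} ij′)))
          IJ  , _ = splitEntry n₀ (n₀ ^ k) ij
          IJ′ , _ = splitEntry n₀ (n₀ ^ k) ij′
      in splitEntry-injective (cong₂ _,_
           (out-injective (trans (proj₂ (out-isGate IJ)) (trans (cong inj₂ g≡g′) (sym (proj₂ (out-isGate IJ′))))))
           e≡e′)

    results-unique : ∀ k → Unique (results k)
    results-unique zero    = [] ∷ []
    results-unique (suc k) = Unique.map⁺ (resultOp-injective {k}) (entries-unique (suc k))

    -- Every member of `products k` is a call, while the results of a subproblem of positive depth
    -- are gates by `out-isGate`; so the two lists joined within a call are disjoint.
    products-unique : ∀ k → Unique (products k)
    products-unique zero    = []
    products-unique (suc k) = Unique.cartesianProductWith⁺ call call-injective (Unique.allFin⁺ m)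
      (Unique.++⁺ (products-unique k) (results-unique k) (disjoint k))
      where
      disjoint : ∀ k {v} → ¬ (v ∈ products k × v ∈ results k)
      disjoint (suc k) (v∈products , v∈results) =
        let _ , _ , _ , _ , v≡call = ∈-cartesianProductWith⁻ call (allFin m) (products k ++ results k) v∈products
            ij , _ , v≡result = ∈-map⁻ (resultOp (suc k)) v∈results
        in call≢gateC (trans (sym v≡call) (trans v≡result (resultOp-isGate {k} ij)))

  -- Places an operation of a subproblem into the whole recursion, at the end of the path `π` of `d`
  -- nested calls.
  at : ∀ {d j} → Vec (Fin m) d → Op j → Op (d + j)
  at []      o = o
  at (r ∷ π) o = call r (at π o)

  at-injective : ∀ {d j} (π : Vec (Fin m) d) {o o′ : Op j} → at π o ≡ at π o′ → o ≡ o′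
  at-injective []      eq = eq
  at-injective (r ∷ π) eq = at-injective π (proj₂ (call-injective eq))

  at-edge : ∀ {d j} (π : Vec (Fin m) d) {o o′ : Op j} → DecEdge o o′ → DecEdge (at π o) (at π o′)
  at-edge []      d = d
  at-edge (r ∷ π) d = below r (at-edge π d)

  spread : ∀ d {j} → List (Op j) → List (Op (d + j))
  spread zero    L = L
  spread (suc d) L = cartesianProductWith call (allFin m) (spread d L)

  spread-unique : ∀ d {j} {L : List (Op j)} → Unique L → Unique (spread d L)
  spread-unique zero    uniqueL = uniqueL
  spread-unique (suc d) uniqueL =
    Unique.cartesianProductWith⁺ call call-injective (Unique.allFin⁺ m) (spread-unique d uniqueL)

  -- Adds one bound for each of the `m ^ d` paths. Two lists are carried along because the bound is
  -- known for products and gates together, while only each list by itself is duplicate-free.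
  ∑-spread : ∀ d {j} (L L′ : List (Op j)) (f : Op (d + j) → ℕ) K →
    (∀ π → K ≤ ∑ L (f ∘ at π) + ∑ L′ (f ∘ at π)) →
    m ^ d * K ≤ ∑ (spread d L) f + ∑ (spread d L′) f
  ∑-spread zero    L L′ f K bound = ℕ.≤-trans (ℕ.≤-reflexive (ℕ.*-identityˡ K)) (bound [])
  ∑-spread (suc d) L L′ f K bound = begin
    m * m ^ d * K
      ≡⟨ ℕ.*-assoc m (m ^ d) K ⟩
    m * (m ^ d * K)
      ≡⟨ cong (_* (m ^ d * K)) (allFin-length m) ⟨
    length (allFin m) * (m ^ d * K)
      ≡⟨ ∑-const (allFin m) (m ^ d * K) ⟨
    ∑ (allFin m) (λ _ → m ^ d * K)
      ≤⟨ ∑-mono (allFin m) (λ r → ∑-spread d L L′ (f ∘ call r) K (λ π → bound (r ∷ π))) ⟩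
    ∑ (allFin m) (λ r → ∑ (spread d L) (f ∘ call r) + ∑ (spread d L′) (f ∘ call r))
      ≡⟨ ∑-+ (allFin m) _ _ ⟩
    ∑ (allFin m) (λ r → ∑ (spread d L) (f ∘ call r)) + ∑ (allFin m) (λ r → ∑ (spread d L′) (f ∘ call r))
      ≡⟨ cong₂ _+_ (∑-product call (allFin m) (spread d L) f) (∑-product call (allFin m) (spread d L′) f) ⟨
    ∑ (spread (suc d) L) f + ∑ (spread (suc d) L′) f ∎
    where open ℕ.≤-Reasoning

  -- The words written for all subproblems together

  module _ (connected : Bilinear.Dec₁Connected R alg) {l l′ : Fin n₀} (l≢l′ : l ≢ l′)
           (n₀²≤m : n₀ ^ 2 ≤ m) .{{_ : NonZero (n₀ ^ 2)}} where

    open RingFacts R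
    open Expansion connected (l , l) n₀²≤m

    private
      1≉0 = connected⇒nontrivial alg connected {l , l} {l , l′} (l≢l′ ∘ proj₂ ∘ ,-injective)
      outG = out-isGate alg connected ev 1≉0 l≢l′
      outI = out-injective alg connected ev 1≉0 l

    done+missing : ∀ j computed → done j computed + missing j computed ≡ (n₀ ^ j) ^ 2
    done+missing j computed = begin
      done j computed + missing j computed       ≡⟨ ∑-+ (entries j) _ _ ⟨
      ∑ (entries j) (λ e → [ computed (resultOp j e) ]₀₁ + [ not (computed (resultOp j e)) ]₀₁)
                                                 ≡⟨ ∑-cong (entries j) (λ e → complement (computed (resultOp j e))) ⟩
      ∑ (entries j) (λ _ → 1)                    ≡⟨ ∑-const (entries j) 1 ⟩
      length (entries j) * 1                     ≡⟨ ℕ.*-identityʳ _ ⟩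
      length (entries j)                         ≡⟨ length-entries j ⟩
      (n₀ ^ j) ^ 2                               ∎
      where
      open ≡-Reasoning
      complement : ∀ b → [ b ]₀₁ + [ not b ]₀₁ ≡ 1
      complement true  = refl
      complement false = refl

    module _ {M d j : ℕ} (impl : TwoLevelMemory.Implementation (graph (d + j)) M)
             (large : 2 * (n₀ ^ 2 * (4 * M)) ≤ (n₀ ^ j) ^ 2) where

      open Memory (graph (d + j)) M _≟ᴼ_
      open TwoLevelMemory.Implementation impl using (words)

      -- The factor `n₀ ^ 2` is the loss in `expansion`. Of the remaining `4 * M`, half may be in
      -- fast memory. By `large`, `K` is at most half of the outputs.
      private K = n₀ ^ 2 * (4 * M)

      -- At the snapshot, `expansion` puts a load of at least `4 * M` on both memories. Fast memory
      -- accounts for at most `M` among the products and `M` among the gates; the rest persists in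
      -- slow memory until the end.
      subproblem-load : ∀ (π : Vec (Fin m) d) → 2 * M ≤ load j (finalOcc impl ∘ at π)
      subproblem-load π = ℕ.+-cancelˡ-≤ (2 * M) _ _ (begin
        2 * M + 2 * M          ≡⟨ ℕ.*-distribʳ-+ M 2 2 ⟨
        4 * M                  ≤⟨ ℕ.*-cancelˡ-≤ (n₀ ^ 2) expanded ⟩
        load j held′           ≤⟨ ℕ.+-mono-≤ (∑-mono (products j) (held-bound ∘ at π))
                                               (∑-mono (gates j) (held-bound ∘ at π)) ⟩
        ∑ (products j) (λ o → fast′ o + final′ o) + ∑ (gates j) (λ o → fast′ o + final′ o)
                               ≡⟨ cong₂ _+_ (∑-+ (products j) fast′ final′) (∑-+ (gates j) fast′ final′) ⟩
        ∑ (products j) fast′ + ∑ (products j) final′ + (∑ (gates j) fast′ + ∑ (gates j) final′)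
                               ≡⟨ +-interchange (∑ (products j) fast′) _ _ _ ⟩
        ∑ (products j) fast′ + ∑ (gates j) fast′ + load j final′
                               ≤⟨ ℕ.+-monoˡ-≤ (load j final′)
                                    (ℕ.+-mono-≤ (fast-share (products-unique outG outI j)) (fast-share (gates-unique j))) ⟩
        M + M + load j final′  ≡⟨ cong (λ x → M + x + load j final′) (ℕ.+-identityʳ M) ⟨
        2 * M + load j final′  ∎)
        where
        open ℕ.≤-Reasoning
        outputs = map (at π) (results j)
        outputs-length : length outputs ≡ (n₀ ^ j) ^ 2
        outputs-length = trans (length-map (at π) (results j))
          (trans (length-map (resultOp j) (entries j)) (length-entries j))
        open Snapshot (snapshot impl {outputs} (Unique.map⁺ (at-injective π) (results-unique outG outI j)) K
          (ℕ.≤-trans (ℕ.m≤n*m K 2) (ℕ.≤-trans large (ℕ.≤-reflexive (sym outputs-length)))))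
        held′ fast′ final′ : Op j → ℕ
        held′  = held ∘ at π
        fast′  = fastOcc ∘ at π
        final′ = finalOcc impl ∘ at π
        fast-share : ∀ {L} → Unique L → ∑ L fast′ ≤ M
        fast-share {L} uniqueL = ℕ.≤-trans (ℕ.≤-reflexive (sym (∑-map (at π) L fastOcc)))
          (∑-fastOcc (Unique.map⁺ (at-injective π) uniqueL))
        consistent : Consistent (computed? ∘ at π) held′
        consistent edge′ =
          let p∈o = DecEdge⇒operand (inj₁ ∘ inj₁) (inj₁ ∘ inj₂) inj₂ (at-edge π edge′)
          in closed p∈o , retained p∈o
        done≡K : done j (computed? ∘ at π) ≡ K
        done≡K = trans (sym (trans (∑-map (at π) (results j) _) (∑-map (resultOp j) (entries j) _))) progressed
        K≤missing : K ≤ missing j (computed? ∘ at π)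
        K≤missing = ℕ.+-cancelˡ-≤ K _ _ (begin
          K + K                                            ≡⟨ cong (K +_) (ℕ.+-identityʳ K) ⟨
          2 * K                                            ≤⟨ large ⟩
          (n₀ ^ j) ^ 2                                     ≡⟨ done+missing j (computed? ∘ at π) ⟨
          done j (computed? ∘ at π) + missing j (computed? ∘ at π) ≡⟨ cong (_+ missing j (computed? ∘ at π)) done≡K ⟩
          K + missing j (computed? ∘ at π)                 ∎)
        expanded : n₀ ^ 2 * (4 * M) ≤ n₀ ^ 2 * load j held′
        expanded = ℕ.≤-trans (ℕ.⊓-glb (ℕ.≤-reflexive (sym done≡K)) K≤missing)
          (expansion j (computed? ∘ at π) held′ consistent)

      -- A word in the final slow memory is counted at most once as a product and once as a gate,
      -- over all subproblems. This double counting cancels against the 2 in the load `2 * M` of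
      -- each subproblem.
      words-bound : m ^ d * M ≤ words
      words-bound = ℕ.*-cancelˡ-≤ 2 (begin
        2 * (m ^ d * M)
          ≡⟨ ℕ.*-assoc 2 (m ^ d) M ⟨
        2 * m ^ d * M
          ≡⟨ cong (_* M) (ℕ.*-comm 2 (m ^ d)) ⟩
        m ^ d * 2 * M
          ≡⟨ ℕ.*-assoc (m ^ d) 2 M ⟩
        m ^ d * (2 * M)
          ≤⟨ ∑-spread d (products j) (gates j) (finalOcc impl) (2 * M) subproblem-load ⟩
        ∑ (spread d (products j)) (finalOcc impl) + ∑ (spread d (gates j)) (finalOcc impl)
          ≤⟨ ℕ.+-mono-≤ (∑-finalOcc impl (spread-unique d (products-unique outG outI j)))
                        (∑-finalOcc impl (spread-unique d (gates-unique j))) ⟩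
        words + words
          ≡⟨ cong (words +_) (ℕ.+-identityʳ words) ⟨
        2 * words ∎)
        where open ℕ.≤-Reasoning

-- Choice of the subproblem size and the final estimate

crossing : ∀ b a (f : ℕ → ℕ) → 1 ≤ b → f 0 ≤ a → (∀ i → f (suc i) ≤ b * f i) → ∀ k → a ≤ f k →
  ∃[ d ] ∃[ j ] d + j ≡ k × a ≤ f j × f j ≤ b * a
crossing b a f 1≤b f0≤a growth zero    a≤f0 =
  0 , 0 , refl , a≤f0 , ℕ.≤-trans f0≤a (ℕ.≤-trans (ℕ.≤-reflexive (sym (ℕ.*-identityˡ a))) (ℕ.*-monoˡ-≤ a 1≤b))
crossing b a f 1≤b f0≤a growth (suc k) a≤f with a ℕ.≤? f k
-- Descending from the top, this is the last index before `f` drops below `a`; one step changes `f`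
-- by a factor of at most `b`, whence the upper bound.
... | no a≰fk = 0 , suc k , refl , a≤f , ℕ.≤-trans (growth k) (ℕ.*-monoʳ-≤ b (ℕ.<⇒≤ (ℕ.≰⇒> a≰fk)))
... | yes a≤fk with d , j , d+j≡k , bounds ← crossing b a f 1≤b f0≤a growth k a≤fk =
  suc d , j , cong suc d+j≡k , bounds

-- The square of n / √M is at most n₀ ^ 2d times n₀ ^ 8; as n₀ ^ p < m ^ q, the latter
-- factor contributes at most m ^ 8q to the 2q-th power of the bound.
exponents : ∀ n₀ m d j M words → m ^ d * M ≤ words → (n₀ ^ j) ^ 2 ≤ n₀ ^ 8 * M →
  WordsAtLeast words 1 (m ^ 4) n₀ m (n₀ ^ (d + j)) M
exponents n₀ m d j M words words-large small p q p/q<ω = begin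
  (1 * M) ^ (2 * q) * (n₀ ^ (d + j)) ^ (2 * p)
    ≡⟨ cong₂ _*_ (cong (_^ (2 * q)) (ℕ.*-identityˡ M)) split-n ⟩
  M ^ (2 * q) * ((n₀ ^ p) ^ (2 * d) * ((n₀ ^ j) ^ 2) ^ p)
    ≤⟨ ℕ.*-monoʳ-≤ (M ^ (2 * q)) (ℕ.*-mono-≤ (ℕ.^-monoˡ-≤ (2 * d) n₀^p≤m^q) (ℕ.^-monoˡ-≤ p small)) ⟩
  M ^ (2 * q) * ((m ^ q) ^ (2 * d) * (n₀ ^ 8 * M) ^ p)
    ≡⟨ cong (λ x → M ^ (2 * q) * ((m ^ q) ^ (2 * d) * x)) (^-distribʳ-* (n₀ ^ 8) M p) ⟩
  M ^ (2 * q) * ((m ^ q) ^ (2 * d) * ((n₀ ^ 8) ^ p * M ^ p))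
    ≡⟨ cong (λ x → M ^ (2 * q) * ((m ^ q) ^ (2 * d) * (x * M ^ p))) (^-swap n₀ 8 p) ⟩
  M ^ (2 * q) * ((m ^ q) ^ (2 * d) * ((n₀ ^ p) ^ 8 * M ^ p))
    ≤⟨ ℕ.*-monoʳ-≤ (M ^ (2 * q)) (ℕ.*-monoʳ-≤ ((m ^ q) ^ (2 * d))
         (ℕ.*-monoˡ-≤ (M ^ p) (ℕ.^-monoˡ-≤ 8 n₀^p≤m^q))) ⟩
  M ^ (2 * q) * ((m ^ q) ^ (2 * d) * ((m ^ q) ^ 8 * M ^ p))
    ≡⟨ cong₂ (λ x y → M ^ (2 * q) * (x * (y * M ^ p))) regroup-d regroup-8 ⟩
  M ^ (2 * q) * ((m ^ d) ^ (2 * q) * ((m ^ 4) ^ (2 * q) * M ^ p))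
    ≡⟨ solve 4 (λ a b c d → a :* (b :* (c :* d)) := c :* (b :* a) :* d) refl
         (M ^ (2 * q)) ((m ^ d) ^ (2 * q)) ((m ^ 4) ^ (2 * q)) (M ^ p) ⟩
  (m ^ 4) ^ (2 * q) * ((m ^ d) ^ (2 * q) * M ^ (2 * q)) * M ^ p
    ≡⟨ cong (λ x → (m ^ 4) ^ (2 * q) * x * M ^ p) (^-distribʳ-* (m ^ d) M (2 * q)) ⟨
  (m ^ 4) ^ (2 * q) * (m ^ d * M) ^ (2 * q) * M ^ p
    ≡⟨ cong (_* M ^ p) (^-distribʳ-* (m ^ 4) (m ^ d * M) (2 * q)) ⟨
  (m ^ 4 * (m ^ d * M)) ^ (2 * q) * M ^ p
    ≤⟨ ℕ.*-monoˡ-≤ (M ^ p) (ℕ.^-monoˡ-≤ (2 * q) (ℕ.*-monoʳ-≤ (m ^ 4) words-large)) ⟩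
  (m ^ 4 * words) ^ (2 * q) * M ^ p ∎
  where
  open ℕ.≤-Reasoning
  open +-*-Solver
  n₀^p≤m^q : n₀ ^ p ≤ m ^ q
  n₀^p≤m^q = ℕ.<⇒≤ p/q<ω
  ^-swap : ∀ a x y → (a ^ x) ^ y ≡ (a ^ y) ^ x
  ^-swap a x y = trans (ℕ.^-*-assoc a x y) (trans (cong (a ^_) (ℕ.*-comm x y)) (sym (ℕ.^-*-assoc a y x)))
  split-n : (n₀ ^ (d + j)) ^ (2 * p) ≡ (n₀ ^ p) ^ (2 * d) * ((n₀ ^ j) ^ 2) ^ p
  split-n = begin-equality
    (n₀ ^ (d + j)) ^ (2 * p)                     ≡⟨ cong (_^ (2 * p)) (ℕ.^-distribˡ-+-* n₀ d j) ⟩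
    (n₀ ^ d * n₀ ^ j) ^ (2 * p)                  ≡⟨ ^-distribʳ-* (n₀ ^ d) (n₀ ^ j) (2 * p) ⟩
    (n₀ ^ d) ^ (2 * p) * (n₀ ^ j) ^ (2 * p)      ≡⟨ cong₂ _*_
      (trans (ℕ.^-*-assoc n₀ d (2 * p)) (trans (cong (n₀ ^_)
        (solve 2 (λ d p → d :* (con 2 :* p) := p :* (con 2 :* d)) refl d p)) (sym (ℕ.^-*-assoc n₀ p (2 * d)))))
      (sym (ℕ.^-*-assoc (n₀ ^ j) 2 p)) ⟩
    (n₀ ^ p) ^ (2 * d) * ((n₀ ^ j) ^ 2) ^ p      ∎
  regroup : ∀ x → (m ^ q) ^ (2 * x) ≡ (m ^ x) ^ (2 * q)
  regroup x = trans (ℕ.^-*-assoc m q (2 * x)) (trans (cong (m ^_)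
    (solve 2 (λ q x → q :* (con 2 :* x) := x :* (con 2 :* q)) refl q x)) (sym (ℕ.^-*-assoc m x (2 * q))))
  regroup-d = regroup d
  regroup-8 : (m ^ q) ^ 8 ≡ (m ^ 4) ^ (2 * q)
  regroup-8 = regroup 4

theorem2 : ∀ {c ℓ : Level} (R : CommutativeRing c ℓ) (n₀ m : ℕ)
    (alg : Bilinear.BilinearAlgorithm R n₀ m) →
    2 / 1 <log[ n₀ ] m →
    log[ n₀ ] m < 3 / 1 →
    Bilinear.Dec₁Connected R alg →
    ∃[ c₁ ] ∃[ c₂ ] ∃[ c₀ ] (0 < c₁ × 0 < c₂ × 1 ≤ c₀ ×
    (∀ (ev : Bilinear.Evaluation R alg) (M k : ℕ) → 1 ≤ M →
    (n₀ ^ k) ≥ c₀ √ M →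
    (impl : TwoLevelMemory.Implementation (Recursion.graph ev k) M) →
    WordsAtLeast (TwoLevelMemory.Implementation.words impl) c₁ c₂ n₀ m (n₀ ^ k) M))
-- The bounds `n₀ ^ 2 < m` and `m < n₀ ^ 3` exclude `n₀ ≤ 1`; hence there are two distinct indices
-- for the rank argument.
theorem2 R zero            (suc m)       alg n₀²<m () connected
theorem2 R (suc zero)      (suc zero)    alg (s≤s ()) m<n₀³ connected
theorem2 R (suc zero)      (suc (suc m)) alg n₀²<m (s≤s ()) connected
theorem2 R n₀@(suc (suc n)) m@(suc _) alg n₀²<m m<n₀³ connected =
  -- The square of `n₀ ^ 3`, times `M`, is the least number of outputs allowed for a subproblem. The
  -- crossing overshoots it by at most `n₀ ^ 2`, which gives the `n₀ ^ 8` that `exponents` turns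
  -- into `m ^ 4`.
  1 , m ^ 4 , n₀ ^ 3 , s≤s z≤n , ℕ.m^n>0 m 4 , ℕ.m^n>0 n₀ 3 , bound
  where
  open ℕ.≤-Reasoning
  n₀²≤m : n₀ ^ 2 ≤ m
  n₀²≤m = ℕ.≤-trans (ℕ.<⇒≤ n₀²<m) (ℕ.≤-reflexive (ℕ.^-identityʳ m))

  bound : ∀ (ev : Bilinear.Evaluation R alg) (M k : ℕ) → 1 ≤ M → (n₀ ^ k) ≥ (n₀ ^ 3) √ M →
    (impl : TwoLevelMemory.Implementation (Recursion.graph ev k) M) →
    WordsAtLeast (TwoLevelMemory.Implementation.words impl) 1 (m ^ 4) n₀ m (n₀ ^ k) M
  bound ev M k 1≤M n-large impl
    with d , j , refl , large , small ← crossing (n₀ ^ 2) ((n₀ ^ 3) ^ 2 * M) (λ i → (n₀ ^ i) ^ 2)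
           (ℕ.m^n>0 n₀ 2) (ℕ.*-mono-≤ (ℕ.m^n>0 (n₀ ^ 3) {{ℕ.m^n≢0 n₀ 3}} 2) 1≤M)
           (λ i → ℕ.≤-reflexive (^-distribʳ-* n₀ (n₀ ^ i) 2)) k n-large =
    exponents n₀ m d j M _ (Paths.words-bound ev connected {zero} {suc zero} (λ ()) n₀²≤m
      {{ℕ.m^n≢0 n₀ 2}} {M} {d} {j} impl (ℕ.≤-trans room large))
      (ℕ.≤-trans small (ℕ.≤-reflexive n₀^8))
    where
    room : 2 * (n₀ ^ 2 * (4 * M)) ≤ (n₀ ^ 3) ^ 2 * M
    room = begin
      2 * (n₀ ^ 2 * (4 * M)) ≡⟨ solve 2 (λ a M → con 2 :* (a :* (con 4 :* M)) := con 8 :* a :* M) refl (n₀ ^ 2) M ⟩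
      -- As `n₀` is at least 2, `n₀ ^ 4` is at least 16, hence at least 8.
      8 * n₀ ^ 2 * M         ≤⟨ ℕ.*-monoˡ-≤ M (ℕ.*-monoˡ-≤ (n₀ ^ 2)
                                  (ℕ.≤-trans (ℕ.m≤n+m 8 8) (ℕ.^-monoˡ-≤ 4 (s≤s (s≤s (z≤n {n})))))) ⟩
      n₀ ^ 4 * n₀ ^ 2 * M    ≡⟨ cong (_* M) (ℕ.^-distribˡ-+-* n₀ 4 2) ⟨
      n₀ ^ 6 * M             ≡⟨ cong (_* M) (ℕ.^-*-assoc n₀ 3 2) ⟨
      (n₀ ^ 3) ^ 2 * M       ∎
      where open +-*-Solver
    n₀^8 : n₀ ^ 2 * ((n₀ ^ 3) ^ 2 * M) ≡ n₀ ^ 8 * M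
    n₀^8 = begin-equality
      n₀ ^ 2 * ((n₀ ^ 3) ^ 2 * M) ≡⟨ cong (λ x → n₀ ^ 2 * (x * M)) (ℕ.^-*-assoc n₀ 3 2) ⟩
      n₀ ^ 2 * (n₀ ^ 6 * M)       ≡⟨ ℕ.*-assoc (n₀ ^ 2) (n₀ ^ 6) M ⟨
      n₀ ^ 2 * n₀ ^ 6 * M         ≡⟨ cong (_* M) (ℕ.^-distribˡ-+-* n₀ 2 6) ⟨
      n₀ ^ 8 * M                  ∎
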